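{- Let $G$ be an undirected multi-graph on $n$ vertices and $m$ edges with designated source $s$ and sink $t$, let $\lambda$ be the capacity of an $(s,t)$-mincut of $G$, and let $f$ be a maximum $(s,t)$-flow in $G$. There is an $\mathcal{O}(\min\{m,n\sqrt{\lambda}\})$ space structure, consisting of a directed acyclic graph $\mathcal{D}$ and the set of at most $n-2$ anchor edges corresponding to $f$, that stores and characterizes all $(s,t)$-mincuts and all minimum+1 $(s,t)$-cuts of $G$ as follows. (1) An $(s,t)$-cut $C$ is an $(s,t)$-mincut in $G$ if and only if $C$ is a $1$-transversal cut in $\mathcal{D}$ to which no anchor edge corresponding to $f$ contributes. (2) An $(s,t)$-cut $C$ is a minimum+1 $(s,t)$-cut in $G$ if and only if $C$ is a $1$-transversal cut in $\mathcal{D}$ to which exactly one anchor edge corresponding to $f$ contributes.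
   Context: A multi-graph is an unweighted graph (edges of capacity 1) with parallel edges allowed. An $(s,t)$-cut of $G=(V,E)$ is a set $C\subset V$ with $s\in C$, $t\in\overline{C}=V\setminus C$. An edge contributes to $C$ if it goes from $C$ to $\overline C$; for an undirected edge this means exactly one endpoint lies in $C$. The capacity of $C$ is the number of contributing edges. $\lambda$ is the minimum capacity of an $(s,t)$-cut; an $(s,t)$-mincut has capacity $\lambda$ and a minimum+1 $(s,t)$-cut has capacity $\lambda+1$. The maximum flow $f$ is integral, so each edge carries flow $0$ or $1$. An edge $e$ is an anchor edge (corresponding to $f$) if $f(e)=0$ and $e$ contributes to some minimum+1 $(s,t)$-cut of $G$. The DAG $\mathcal D$ is a directed acyclic graph each of whose nodes corresponds to a subset of $V$, these subsets partitioning $V$; a cut $C$ of $G$ is a cut in $\mathcal D$ if it does not split the vertex set of any node. The edge-set of a cut is the set of edges with exactly one endpoint in the cut. A cut in $\mathcal D$ is $1$-transversal if its edge-set in $\mathcal D$ intersects every (directed) path of $\mathcal D$ at most once.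
   Formalization: The total space bound is stated for λ ≥ 1 and G without isolated vertices, as it fails otherwise (e.g. λ = 0 with n−2 anchor edges); the bound on the edges of D, the n−2 bound and (1), (2) hold for all G. -}

module Defs where

import Algebra.Properties.CommutativeMonoid.Sum as Sum
open import Data.Bool.Base using (_xor_; if_then_else_)
open import Data.Fin.Base using (Fin)
open import Data.Fin.Properties using (_≟_; any?)
open import Data.Fin.Subset using (Subset; _∈_; _∉_; ∣_∣)
open import Data.Fin.Subset.Properties using (_∈?_)
open import Data.Integer.Base as ℤ using (ℤ; 0ℤ)
import Data.Integer.Properties as ℤ
open import Data.List.Base using (List; []; _∷_; length; filter)
open import Data.Nat.Base using (ℕ; suc; _+_; _*_; _^_; _≤_)
open import Data.Product.Base using (∃; ∃-syntax; _×_; _,_)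
open import Data.Sum.Base using (_⊎_)
open import Data.Vec.Base using (lookup; tabulate)
open import Function.Definitions using (StrictlySurjective)
open import Relation.Binary.Construct.Closure.ReflexiveTransitive using (Star; ε; _◅_)
open import Relation.Binary.Construct.Closure.Transitive using (TransClosure)
open import Relation.Binary.PropositionalEquality.Core using (_≡_; _≢_)
open import Relation.Nullary.Decidable.Core using (does; _×-dec_)
open import Relation.Nullary.Negation.Core using (¬_)

open Sum ℤ.+-0-commutativeMonoid using (sum)

-- Edges are named by Fin m, so parallel edges are distinct elements.
-- The order of the two ends of an edge carries no meaning; it only fixes
-- the sign convention for flows.  Loops are not excluded: they contribute to
-- no cut.
record MultiGraph (n m : ℕ) : Set where
  field
    end₁ end₂ : Fin m → Fin n

-- The edges with exactly one endpoint in C.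
edgeSet : ∀ {n m} (x y : Fin m → Fin n) → Subset n → Subset m
edgeSet x y C = tabulate λ e → lookup C (x e) xor lookup C (y e)

module _ {n m : ℕ} (G : MultiGraph n m) where
  open MultiGraph G

  contributing : Subset n → Subset m
  contributing = edgeSet end₁ end₂

  capacity : Subset n → ℕ
  capacity C = ∣ contributing C ∣

  NoIsolatedVertex : Set
  NoIsolatedVertex = ∀ v → ∃[ e ] (end₁ e ≡ v ⊎ end₂ e ≡ v)

  -- f e > 0 is flow from end₁ e to end₂ e, f e < 0 is flow from end₂ e to end₁ e.
  netOutflow : (Fin m → ℤ) → Fin n → ℤ
  netOutflow f v = sum λ e →
    (if does (end₁ e ≟ v) then f e else 0ℤ) ℤ.-
    (if does (end₂ e ≟ v) then f e else 0ℤ)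

  module _ (s t : Fin n) where

    IsCut : Subset n → Set
    IsCut C = s ∈ C × t ∉ C

    IsMinCutCapacity : ℕ → Set
    IsMinCutCapacity k = (∃[ C ] (IsCut C × capacity C ≡ k)) × (∀ C → IsCut C → k ≤ capacity C)

    record IsFlow (f : Fin m → ℤ) : Set where
      field
        capacityBound : ∀ e → ℤ.∣ f e ∣ ≤ 1
        conservation  : ∀ v → v ≢ s → v ≢ t → netOutflow f v ≡ 0ℤ

    value : (Fin m → ℤ) → ℤ
    value f = netOutflow f s

    IsMaxFlow : (Fin m → ℤ) → Set
    IsMaxFlow f = IsFlow f × (∀ g → IsFlow g → value g ℤ.≤ value f)

    -- The number k is meant to be the capacity of an (s,t)-mincut.
    IsAnchor : ℕ → (Fin m → ℤ) → Fin m → Set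
    IsAnchor k f e = f e ≡ 0ℤ ×
      (∃[ C ] (IsCut C × capacity C ≡ suc k × e ∈ contributing C))

-- A directed acyclic graph whose nodes partition Fin n into nonempty blocks;
-- node v is the block of v.
record DAG (n : ℕ) : Set where
  field
    nodes edges : ℕ
    node        : Fin n → Fin nodes
    nonempty    : StrictlySurjective _≡_ node
    tail head   : Fin edges → Fin nodes

  _⟶_ : Fin nodes → Fin nodes → Set
  x ⟶ y = ∃[ e ] (tail e ≡ x × head e ≡ y)

  field
    acyclic : ∀ x → ¬ TransClosure _⟶_ x x

  Path : Fin nodes → Fin nodes → Set
  Path = Star _⟶_

  pathEdges : ∀ {x y} → Path x y → List (Fin edges)
  pathEdges ε             = []
  pathEdges ((e , _) ◅ p) = e ∷ pathEdges p

  IsCutIn : Subset n → Set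
  IsCutIn C = ∀ u v → node u ≡ node v → u ∈ C → v ∈ C

  image : Subset n → Subset nodes
  image C = tabulate λ x → does (any? λ v → (v ∈? C) ×-dec (node v ≟ x))

  dagEdgeSet : Subset n → Subset edges
  dagEdgeSet C = edgeSet tail head (image C)

  -- By acyclicity no edge is repeated on a path, so the length counts
  -- distinct edges.
  OneTransversal : Subset n → Set
  OneTransversal C = IsCutIn C ×
    (∀ {x y} (p : Path x y) → length (filter (_∈? dagEdgeSet C) (pathEdges p)) ≤ 1)

-- x ≤ c · min {m , n √k}, with the square root cleared by squaring.
BoundedByMin : (c x m n k : ℕ) → Set
BoundedByMin c x m n k = x ≤ c * m × x ^ 2 ≤ (c * n) ^ 2 * k

-- Space in words: the block of each vertex, the nodes and edges of the DAG,
-- and the anchor edges A.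
space : ∀ {n m} → DAG n → Subset m → ℕ
space {n} D A = n + DAG.nodes D + DAG.edges D + ∣ A ∣

{-# OPTIONS --safe #-}

-- Flow conservation and max-flow min-cut give, for every (s,t)-cut C,
--   capacity C = λ + 2 · #(flow edges entering C) + #(contributing edges without flow).
-- Hence capacity λ (respectively λ + 1) means that no flow edge enters C and that no edge
-- (exactly one edge, necessarily an anchor) without flow contributes.  The nodes of the DAG
-- are the strongly connected components of the flow edges together with the non-anchor
-- edges without flow in both directions; its arcs are the distinct pairs of components joined
-- by a flow edge.  If a flow edge entered an unsplit cut, then the flow would go on from
-- its head to t, and the resulting path would cross the cut twice.
--
-- Each anchor has a cut which no other anchor crosses, and no anchor crosses a mincut; so the
-- anchors form a forest that does not connect s to t.  At most λ arcs pass each level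
-- of a topological numbering, so the total length of the arcs is at most n λ, while at most
-- n L arcs are shorter than L; L = ⌊√λ⌋ gives O(n √λ) arcs.

module Submission where

open import Defs
import Algebra.Properties.CommutativeMonoid.Sum as Sum
import Algebra.Properties.Semiring.Sum as SemiringSum
open import Data.Bool.Base using (Bool; true; false; _xor_; if_then_else_)
open import Data.Bool.Properties using () renaming (_≟_ to _≟ᵇ_)
open import Data.Empty using (⊥-elim)
open import Data.Fin.Base as Fin
  using (Fin; zero; suc; toℕ; fromℕ<; punchIn; punchOut; combine; remQuot)
open import Data.Fin.Properties as Fin
  using (_≟_; any?; toℕ<n; toℕ-injective; toℕ-fromℕ<; punchIn-injective; punchInᵢ≢i;
    punchIn-mono-≤; punchIn-punchOut; combine-injective; remQuot-combine; combine-remQuot;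
    injective⇒≤)
open import Data.Fin.Subset using (Subset; inside; outside; _∈_; _∉_; _⊆_; _∩_; _∪_; ⁅_⁆; ⊤; ∣_∣)
open import Data.Fin.Subset.Properties
  using (_∈?_; p⊂q⇒∣p∣<∣q∣; ∣p∣≤n; ∣⊤∣≡n; x∈⁅x⁆; x∈⁅y⁆⇒x≡y; x∈p∪q⁻; x∈p∩q⁺; x∈p∩q⁻; p⊆p∪q;
    q⊆p∪q; ⊆-antisym; anySubset?)
open import Data.Integer.Base as ℤ using (ℤ; +_; -[1+_]; 0ℤ; 1ℤ; -1ℤ)
import Data.Integer.Properties as ℤ
import Data.Integer.Tactic.RingSolver as ℤ-Solver
open import Data.List.Base using (length; filter)
open import Data.List.Properties using (filter-accept; filter-reject)
open import Data.Nat.Base as ℕ using (ℕ; zero; suc; _+_; _*_; _∸_; _^_; _≤_; _<_; z≤n; s≤s)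
import Data.Nat.Properties as ℕ
import Data.Nat.Tactic.RingSolver as ℕ-Solver
open import Data.Product.Base using (Σ-syntax; ∃-syntax; _×_; _,_; proj₁; proj₂)
open import Data.Sum.Base using (_⊎_; inj₁; inj₂)
open import Data.Vec.Base using ([]; _∷_; here; there; lookup; tabulate)
open import Data.Vec.Properties using (lookup∘tabulate; []=⇒lookup; lookup⇒[]=)
open import Function.Base using (_∘_; id)
open import Function.Bundles using (_⇔_; mk⇔)
open import Relation.Binary.Construct.Closure.ReflexiveTransitive using (Star; ε; _◅_; _◅◅_)
open import Relation.Binary.Construct.Closure.Transitive using (TransClosure; [_]; _∷_)
open import Relation.Binary.PropositionalEquality
  using (_≡_; _≢_; refl; sym; trans; cong; cong₂; subst; subst₂; module ≡-Reasoning)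
open import Relation.Nullary using (¬_; Dec; yes; no; does; contradiction; ¬?; _×-dec_; _⊎-dec_)
open import Relation.Nullary.Decidable using (dec-true; dec-false; decidable-stable)
open import Relation.Unary using (Decidable)

open Sum ℕ.+-0-commutativeMonoid
  using () renaming (sum to sumℕ; ∑-comm to ∑ℕ-comm; ∑-distrib-+ to ∑ℕ-distrib-+)
open Sum ℤ.+-0-commutativeMonoid using (sum; ∑-comm; ∑-distrib-+; sum-cong-≗; sum-replicate-zero)
open SemiringSum ℤ.+-*-semiring using (*-distribˡ-sum)

-- Finite subsets

module _ {n} {P : Fin n → Set} (P? : Decidable P) where

  subsetOf : Subset n
  subsetOf = tabulate λ i → does (P? i)

  ∈-subsetOf⁺ : ∀ {i} → P i → i ∈ subsetOf
  ∈-subsetOf⁺ {i} pi = lookup⇒[]= i _ (trans (lookup∘tabulate _ i) (dec-true (P? i) pi))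

  ∈-subsetOf⁻ : ∀ {i} → i ∈ subsetOf → P i
  ∈-subsetOf⁻ {i} i∈ with P? i | trans (sym (lookup∘tabulate (λ i → does (P? i)) i)) ([]=⇒lookup i∈)
  ... | yes pi | _ = pi

enum : ∀ {n} (p : Subset n) → Fin ∣ p ∣ → Fin n
enum (inside  ∷ p) zero    = zero
enum (inside  ∷ p) (suc i) = suc (enum p i)
enum (outside ∷ p) i       = suc (enum p i)

enum-∈ : ∀ {n} (p : Subset n) i → enum p i ∈ p
enum-∈ (inside  ∷ p) zero    = here
enum-∈ (inside  ∷ p) (suc i) = there (enum-∈ p i)
enum-∈ (outside ∷ p) i       = there (enum-∈ p i)

enum-injective : ∀ {n} (p : Subset n) {i j} → enum p i ≡ enum p j → i ≡ j
enum-injective (inside  ∷ p) {zero}  {zero}  _  = refl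
enum-injective (inside  ∷ p) {suc i} {suc j} eq = cong suc (enum-injective p (Fin.suc-injective eq))
enum-injective (outside ∷ p)                 eq = enum-injective p (Fin.suc-injective eq)

enum-surjective : ∀ {n} (p : Subset n) {x} → x ∈ p → ∃[ i ] enum p i ≡ x
enum-surjective (inside  ∷ p) here       = zero , refl
enum-surjective (inside  ∷ p) (there x∈) = let i , eq = enum-surjective p x∈ in suc i , cong suc eq
enum-surjective (outside ∷ p) (there x∈) = let i , eq = enum-surjective p x∈ in i , cong suc eq

∣∣-mono-injection : ∀ {m n} (p : Subset m) (q : Subset n) (h : Fin m → Fin n) →
  (∀ {i} → i ∈ p → h i ∈ q) → (∀ {i j} → i ∈ p → j ∈ p → h i ≡ h j → i ≡ j) → ∣ p ∣ ≤ ∣ q ∣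
∣∣-mono-injection p q h h∈ inj = injective⇒≤ {f = λ i → proj₁ (index i)} λ {i} {j} eq →
  enum-injective p (inj (enum-∈ p i) (enum-∈ p j)
    (trans (sym (proj₂ (index i))) (trans (cong (enum q) eq) (proj₂ (index j)))))
  where
  index : ∀ i → ∃[ k ] enum q k ≡ h (enum p i)
  index i = enum-surjective q (h∈ (enum-∈ p i))

∣p∣≡0⇒∉ : ∀ {n} (p : Subset n) {x} → ∣ p ∣ ≡ 0 → x ∉ p
∣p∣≡0⇒∉ p eq x∈ with () ← subst Fin eq (proj₁ (enum-surjective p x∈))

∣p∣≡1⇒unique : ∀ {n} (p : Subset n) {x y} → ∣ p ∣ ≡ 1 → x ∈ p → y ∈ p → x ≡ y
∣p∣≡1⇒unique p eq x∈ y∈ =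
  let i , ei = enum-surjective p x∈
      j , ej = enum-surjective p y∈
  in trans (sym ei) (trans (cong (enum p) (irr eq i j)) ej)
  where
  irr : ∀ {k} → k ≡ 1 → (i j : Fin k) → i ≡ j
  irr refl zero zero = refl

nonempty-∣∣ : ∀ {n} (p : Subset n) {k} → ∣ p ∣ ≡ suc k → ∃[ x ] x ∈ p
nonempty-∣∣ p eq = let i = subst Fin (sym eq) zero in enum p i , enum-∈ p i

∉⇒∣∣≡0 : ∀ {n} (p : Subset n) → (∀ x → x ∉ p) → ∣ p ∣ ≡ 0
∉⇒∣∣≡0 p none with ∣ p ∣ in eq
... | zero  = refl
... | suc k = contradiction (proj₂ (nonempty-∣∣ p eq)) (none _)

∣tabulate∣ : ∀ {n} (b : Fin n → Bool) → ∣ tabulate b ∣ ≡ sumℕ λ i → if b i then 1 else 0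
∣tabulate∣ {zero}  b = refl
∣tabulate∣ {suc n} b with b zero
... | true  = cong suc (∣tabulate∣ (b ∘ suc))
... | false = ∣tabulate∣ (b ∘ suc)

sumℕ-cong : ∀ {n} {f g : Fin n → ℕ} → (∀ i → f i ≡ g i) → sumℕ f ≡ sumℕ g
sumℕ-cong {zero}  f≗g = refl
sumℕ-cong {suc n} f≗g = cong₂ _+_ (f≗g zero) (sumℕ-cong (f≗g ∘ suc))

double-count : ∀ {k l} (b : Fin k → Fin l → Bool) →
  sumℕ (λ i → ∣ tabulate (b i) ∣) ≡ sumℕ (λ j → ∣ tabulate (λ i → b i j) ∣)
double-count b =
  trans (sumℕ-cong λ i → ∣tabulate∣ (b i))
 (trans (∑ℕ-comm λ i j → if b i j then 1 else 0)
        (sumℕ-cong λ j → sym (∣tabulate∣ λ i → b i j)))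

sumℕ-≤ : ∀ {n} (w : Fin n → ℕ) c → (∀ i → w i ≤ c) → sumℕ w ≤ n * c
sumℕ-≤ {zero}  w c w≤c = z≤n
sumℕ-≤ {suc n} w c w≤c = ℕ.+-mono-≤ (w≤c zero) (sumℕ-≤ (w ∘ suc) c (w≤c ∘ suc))

-- Indices outside `P` pay `c` each through their weight; the second summand pays for those in `P`,
-- which avoids subtraction.
≤-sumℕ : ∀ {n} (w : Fin n → ℕ) c {P : Fin n → Set} (P? : Decidable P) → (∀ i → ¬ P i → c ≤ w i) →
  n * c ≤ sumℕ w + ∣ subsetOf P? ∣ * c
≤-sumℕ {zero}  w c P? c≤w = z≤n
≤-sumℕ {suc n} w c P? c≤w with P? zero | ≤-sumℕ (w ∘ suc) c (P? ∘ suc) (c≤w ∘ suc)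
... | yes _ | ih = begin
  c + n * c             ≤⟨ ℕ.+-monoʳ-≤ c ih ⟩
  c + (S + k * c)       ≡⟨ shuffle c S (k * c) ⟩
  S + (c + k * c)       ≤⟨ ℕ.+-monoˡ-≤ _ (ℕ.m≤n+m S (w zero)) ⟩
  w zero + S + suc k * c ∎
  where
  open ℕ.≤-Reasoning
  S = sumℕ (w ∘ suc)
  k = ∣ subsetOf (P? ∘ suc) ∣
  shuffle : ∀ a b d → a + (b + d) ≡ b + (a + d)
  shuffle = ℕ-Solver.solve-∀
... | no ¬p | ih = begin
  c + n * c             ≤⟨ ℕ.+-mono-≤ (c≤w zero ¬p) ih ⟩
  w zero + (S + k * c)  ≡⟨ ℕ.+-assoc (w zero) S (k * c) ⟨
  w zero + S + k * c    ∎
  where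
  open ℕ.≤-Reasoning
  S = sumℕ (w ∘ suc)
  k = ∣ subsetOf (P? ∘ suc) ∣

-- The number of edges of a layered simple graph

module _ {N X : ℕ} (a b : Fin X → Fin N) (a<b : ∀ i → a i Fin.< b i)
  (simple : ∀ {i j} → a i ≡ a j → b i ≡ b j → i ≡ j) where

  -- The interval is half-open, so an arc straddles exactly as many levels as its length
  -- `b i - a i`.
  straddles? : ∀ i (j : Fin N) → Dec (a i Fin.≤ j × j Fin.< b i)
  straddles? i j = (a i Fin.≤? j) ×-dec (j Fin.<? b i)

  span : Fin X → ℕ
  span i = ∣ subsetOf (straddles? i) ∣

  short? : ∀ L i → Dec (toℕ (b i) < L + toℕ (a i))
  short? L i = toℕ (b i) ℕ.<? L + toℕ (a i)

  -- An arc of length at least `L` straddles the `L` levels `a i`, `a i + 1`, ..., `a i + L - 1`.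
  long⇒≤span : ∀ L i → ¬ toℕ (b i) < L + toℕ (a i) → L ≤ span i
  long⇒≤span L i long = subst (_≤ span i) (∣⊤∣≡n L)
    (∣∣-mono-injection ⊤ (subsetOf (straddles? i)) level
      (λ {l} _ → ∈-subsetOf⁺ (straddles? i)
        ( subst (toℕ (a i) ≤_) (sym (toℕ-fromℕ< (<N l))) (ℕ.m≤n+m _ (toℕ l))
        , subst (_< toℕ (b i)) (sym (toℕ-fromℕ< (<N l))) (<b l)))
      (λ {l} {l'} _ _ eq → toℕ-injective (ℕ.+-cancelʳ-≡ _ _ _
        (trans (sym (toℕ-fromℕ< (<N l))) (trans (cong toℕ eq) (toℕ-fromℕ< (<N l')))))))
    where
    <b : ∀ (l : Fin L) → toℕ l + toℕ (a i) < toℕ (b i)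
    <b l = ℕ.≤-trans (ℕ.+-monoˡ-≤ _ (toℕ<n l)) (ℕ.≮⇒≥ long)
    <N : ∀ (l : Fin L) → toℕ l + toℕ (a i) < N
    <N l = ℕ.<-trans (<b l) (toℕ<n (b i))
    level : Fin L → Fin N
    level l = fromℕ< (<N l)

  -- By simplicity an arc is determined by its lower end and its length, and a short arc has only
  -- `L` possible lengths.
  ∣short∣≤ : ∀ L → ∣ subsetOf (short? L) ∣ ≤ N * L
  ∣short∣≤ L = injective⇒≤ {f = code} λ {x} {y} eq →
    let ea , el = combine-injective _ (offset x) _ (offset y) eq
    in enum-injective p (simple ea (toℕ-injective (begin
      toℕ (b (e x))                               ≡⟨ ℕ.m∸n+n≡m (ℕ.<⇒≤ (a<b (e x))) ⟨
      toℕ (b (e x)) ∸ toℕ (a (e x)) + toℕ (a (e x)) ≡⟨ cong₂ _+_ (trans (sym (toℕ-fromℕ< (<L x)))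
                                                       (trans (cong toℕ el) (toℕ-fromℕ< (<L y)))) (cong toℕ ea) ⟩
      toℕ (b (e y)) ∸ toℕ (a (e y)) + toℕ (a (e y)) ≡⟨ ℕ.m∸n+n≡m (ℕ.<⇒≤ (a<b (e y))) ⟩
      toℕ (b (e y))                               ∎)))
    where
    open ≡-Reasoning
    p = subsetOf (short? L)
    e = enum p
    <L : ∀ x → toℕ (b (e x)) ∸ toℕ (a (e x)) < L
    <L x = ℕ.+-cancelʳ-< (toℕ (a (e x))) _ _
      (subst (_< L + toℕ (a (e x))) (sym (ℕ.m∸n+n≡m (ℕ.<⇒≤ (a<b (e x))))) (∈-subsetOf⁻ (short? L) (enum-∈ p x)))
    offset : ∀ x → Fin L
    offset x = fromℕ< (<L x)
    code : ∀ x → Fin (N * L)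
    code x = combine (a (e x)) (offset x)

  module _ (lam : ℕ) (levels : ∀ j → ∣ subsetOf (λ i → straddles? i j) ∣ ≤ lam) where

    -- Incidences between arcs and levels are counted by level instead of by arc.
    sum-span≤ : sumℕ span ≤ N * lam
    sum-span≤ = subst (_≤ N * lam) (sym (double-count λ i j → does (straddles? i j))) (sumℕ-≤ _ lam levels)

    size-bound : ∀ L → X * L ≤ N * lam + N * L * L
    size-bound L = ℕ.≤-trans (≤-sumℕ span L (short? L) (long⇒≤span L))
      (ℕ.+-mono-≤ sum-span≤ (ℕ.*-monoˡ-≤ L (∣short∣≤ L)))

    -- Every arc has length at least one, so at `L = 1` none is short. This covers `lam = 0`, where
    -- `size-bound` at `L = 0` gives nothing.
    size≤ : X ≤ N * lam
    size≤ = ℕ.≤-trans (subst₂ _≤_ (ℕ.*-identityʳ X) (trans (cong (λ k → sumℕ span + k * 1) none) (ℕ.+-identityʳ _))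
              (≤-sumℕ span 1 (short? 1) (long⇒≤span 1))) sum-span≤
      where
      none : ∣ subsetOf (short? 1) ∣ ≡ 0
      none = ∉⇒∣∣≡0 _ λ i i∈ → ℕ.<⇒≱ (a<b i) (ℕ.s≤s⁻¹ (∈-subsetOf⁻ (short? 1) i∈))

-- Integer square roots and the choice of the length threshold

sqrt : ∀ k → ∃[ L ] (L * L ≤ k × k < suc L * suc L)
sqrt zero = 0 , z≤n , s≤s z≤n
sqrt (suc k) with sqrt k
... | L , lo , hi with suc L * suc L ℕ.≤? suc k
...   | yes le = suc L , le , ℕ.≤-<-trans hi (ℕ.*-mono-< (ℕ.n<1+n (suc L)) (ℕ.n<1+n (suc L)))
...   | no nle = L , ℕ.m≤n⇒m≤1+n lo , ℕ.≰⇒> nle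

-- The bound on X * L is used at L = ⌊√ lam⌋.
size≤sqrt : ∀ {X N lam} → X ≤ N * lam → (∀ L → X * L ≤ N * lam + N * L * L) →
  ∃[ L ] (L * L ≤ lam × (1 ≤ lam → 1 ≤ L) × X ≤ 5 * N * L)
size≤sqrt {X} {N} {zero} X≤0 bound = 0 , z≤n , (λ ()) ,
  subst (X ≤_) (trans (ℕ.*-zeroʳ N) (sym (ℕ.*-zeroʳ (5 * N)))) X≤0
size≤sqrt {X} {N} {suc k} _ bound with sqrt (suc k)
... | zero , _ , s≤s ()
... | suc L , lo , hi = suc L , lo , (λ _ → s≤s z≤n) , ℕ.*-cancelʳ-≤ X (5 * N * M) M (begin
  X * M                        ≤⟨ bound M ⟩
  -- Here `suc k` is below `(M + 1)²`, which is at most `(2M)² = 4M²`; together with the short arcs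
  -- this makes the constant 5.
  N * suc k + N * M * M        ≤⟨ ℕ.+-monoˡ-≤ _ (ℕ.*-monoʳ-≤ N (ℕ.≤-trans (ℕ.<⇒≤ hi) (ℕ.*-mono-≤ M+1≤ M+1≤))) ⟩
  N * ((M + M) * (M + M)) + N * M * M ≡⟨ identity N M ⟩
  5 * N * M * M                ∎)
  where
  open ℕ.≤-Reasoning
  M = suc L
  M+1≤ : suc M ≤ M + M
  M+1≤ = ℕ.+-monoˡ-≤ M (s≤s z≤n)
  identity : ∀ N M → N * ((M + M) * (M + M)) + N * M * M ≡ 5 * N * M * M
  identity = ℕ-Solver.solve-∀

-- Closures and reachability

module _ {n} {step : Fin n → Fin n → Set} (step? : ∀ u w → Dec (step u w))
  (Inv : Subset n → Set)
  (extend : ∀ {S u w} → Inv S → u ∈ S → w ∉ S → step u w → Inv (S ∪ ⁅ w ⁆)) where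

  Closed : Subset n → Set
  Closed T = ∀ {u w} → u ∈ T → step u w → w ∈ T

  -- Vertices are added one at a time along a step that leaves the set. The invariant is left open
  -- so that the same search serves reachability and flow augmentation.
  closure : ∀ {S} → Inv S → ∃[ T ] (S ⊆ T × Inv T × Closed T)
  closure {S} inv = go n S inv (ℕ.m≤m+n n ∣ S ∣)
    where
    exit? : ∀ S → Dec (∃[ u ] (u ∈ S × ∃[ w ] (¬ w ∈ S × step u w)))
    exit? S = any? λ u → (u ∈? S) ×-dec any? λ w → ¬? (w ∈? S) ×-dec step? u w

    -- The fuel `k` bounds the number of vertices still outside `S`.
    go : ∀ k S → Inv S → n ≤ k + ∣ S ∣ → ∃[ T ] (S ⊆ T × Inv T × Closed T)
    go k S inv bound with exit? S
    ... | no none = S , id , inv , λ {u} {w} u∈ uw → decided u∈ uw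
      where
      decided : Closed S
      decided {u} {w} u∈ uw with w ∈? S
      ... | yes w∈ = w∈
      ... | no w∉  = contradiction (u , u∈ , w , w∉ , uw) none
    ... | yes (u , u∈ , w , w∉ , uw) = grow k bound
      where
      S⁺ = S ∪ ⁅ w ⁆
      larger : ∣ S ∣ < ∣ S⁺ ∣
      larger = p⊂q⇒∣p∣<∣q∣ (p⊆p∪q ⁅ w ⁆ , w , q⊆p∪q S ⁅ w ⁆ (x∈⁅x⁆ w) , w∉)
      grow : ∀ k → n ≤ k + ∣ S ∣ → ∃[ T ] (S ⊆ T × Inv T × Closed T)
      grow zero    bound = contradiction (ℕ.≤-trans larger (∣p∣≤n S⁺)) (ℕ.≤⇒≯ bound)
      grow (suc k) bound =
        let T , S⁺⊆T , rest = go k S⁺ (extend inv u∈ w∉ uw)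
              (ℕ.≤-trans bound (ℕ.≤-trans (ℕ.≤-reflexive (sym (ℕ.+-suc k ∣ S ∣))) (ℕ.+-monoʳ-≤ k larger)))
        in T , S⁺⊆T ∘ p⊆p∪q ⁅ w ⁆ , rest

module Reachability {n} {step : Fin n → Fin n → Set} (step? : ∀ u w → Dec (step u w)) (u : Fin n) where

  abstract
    reached : ∃[ T ] (⁅ u ⁆ ⊆ T × (∀ {v} → v ∈ T → Star step u v) × (∀ {v w} → v ∈ T → step v w → w ∈ T))
    reached = closure step? (λ S → ∀ {v} → v ∈ S → Star step u v) extend
      λ v∈ → subst (Star step u) (sym (x∈⁅y⁆⇒x≡y u v∈)) ε
      where
      extend : ∀ {S v w} → (∀ {v} → v ∈ S → Star step u v) → v ∈ S → w ∉ S → step v w →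
        ∀ {x} → x ∈ S ∪ ⁅ w ⁆ → Star step u x
      extend {S} {v} {w} star v∈ _ vw x∈ with x∈p∪q⁻ S ⁅ w ⁆ x∈
      ... | inj₁ x∈S = star x∈S
      ... | inj₂ x∈w = subst (Star step u) (sym (x∈⁅y⁆⇒x≡y w x∈w)) (star v∈ ◅◅ (vw ◅ ε))

  reach : Subset n
  reach = proj₁ reached

  start∈reach : u ∈ reach
  start∈reach = proj₁ (proj₂ reached) (x∈⁅x⁆ u)

  ∈reach⇒Star : ∀ {v} → v ∈ reach → Star step u v
  ∈reach⇒Star = proj₁ (proj₂ (proj₂ reached))

  reach-closed : ∀ {v w} → v ∈ reach → step v w → w ∈ reach
  reach-closed = proj₂ (proj₂ (proj₂ reached))

  Star⇒∈reach : ∀ {v} → Star step u v → v ∈ reach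
  Star⇒∈reach = along start∈reach
    where
    along : ∀ {x v} → x ∈ reach → Star step x v → v ∈ reach
    along x∈ ε        = x∈
    along x∈ (xy ◅ p) = along (reach-closed x∈ xy) p

Star? : ∀ {n} {step : Fin n → Fin n → Set} → (∀ u w → Dec (step u w)) → ∀ u v → Dec (Star step u v)
Star? step? u v with v ∈? Reachability.reach step? u
... | yes v∈ = yes (Reachability.∈reach⇒Star step? u v∈)
... | no v∉  = no λ p → v∉ (Reachability.Star⇒∈reach step? u p)

-- Topological numbering of the classes of a preorder

-- For a preorder, two vertices share a class exactly when each is related to the other: `monotone`
-- in both directions gives one half, `reflects` the other.
record Numbering {n} (R : Fin n → Fin n → Set) : Set where
  field
    classes    : ℕ
    class      : Fin n → Fin classes
    surjective : ∀ c → ∃[ v ] class v ≡ c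
    monotone   : ∀ {u v} → R u v → class u Fin.≤ class v
    reflects   : ∀ {u v} → class u ≡ class v → R u v

-- A down-closed predicate holds on an initial segment; `p` is its length, which may be `k`.
threshold : ∀ {k} {P : Fin k → Set} → Decidable P → (∀ {i j} → i Fin.≤ j → P j → P i) →
  Σ[ p ∈ Fin (suc k) ] (∀ i → (P i → i Fin.< p) × (i Fin.< p → P i))
threshold {zero} P? down = zero , λ ()
threshold {suc k} P? down with P? zero
... | no ¬p = zero , λ i → (λ pi → contradiction (down z≤n pi) ¬p) , λ ()
... | yes p₀ with threshold (P? ∘ suc) (λ i≤j → down (s≤s i≤j))
...   | p , spec = suc p , λ where
  zero    → (λ _ → s≤s z≤n) , (λ _ → p₀)
  (suc i) → (λ pi → s≤s (proj₁ (spec i) pi)) , (λ lt → proj₂ (spec i) (ℕ.s≤s⁻¹ lt))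

punchIn-≤ : ∀ {k} (p : Fin (suc k)) i → i Fin.< p → punchIn p i Fin.≤ p
punchIn-≤ (suc p) zero    _  = z≤n
punchIn-≤ (suc p) (suc i) lt = s≤s (punchIn-≤ p i (ℕ.s≤s⁻¹ lt))

≤-punchIn : ∀ {k} (p : Fin (suc k)) i → ¬ i Fin.< p → p Fin.≤ punchIn p i
≤-punchIn zero    i       _  = z≤n
≤-punchIn (suc p) zero    nl = contradiction (s≤s z≤n) nl
≤-punchIn (suc p) (suc i) nl = s≤s (≤-punchIn p i (nl ∘ s≤s))

-- Insertion of vertex `zero` into a numbering of the others: it joins the class of an equivalent
-- vertex if there is one, and otherwise forms a new class just above every class that lies at or
-- below one of its predecessors.
number : ∀ {n} {R : Fin n → Fin n → Set} → (∀ u v → Dec (R u v)) → (∀ {u} → R u u) →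
  (∀ {u v w} → R u v → R v w → R u w) → Numbering R
number {zero} R? rfl tra = record
  { classes = 0 ; class = id ; surjective = λ ()
  ; monotone = λ {u} → ⊥-elim (Fin.¬Fin0 u) ; reflects = λ {u} → ⊥-elim (Fin.¬Fin0 u) }
number {suc n} {R} R? rfl tra = insert (any? λ v → R? zero (suc v) ×-dec R? (suc v) zero)
  where
  open Numbering (number (λ u v → R? (suc u) (suc v)) rfl tra)

  insert : Dec (∃[ v ] (R zero (suc v) × R (suc v) zero)) → Numbering R
  insert (yes (v , 0v , v0)) = record
    { classes = classes ; class = class′
    ; surjective = λ c → let w , eq = surjective c in suc w , eq
    ; monotone = λ {u} {w} → mono u w ; reflects = λ {u} {w} → refl′ u w }
    where
    class′ : Fin (suc n) → Fin classes
    class′ zero    = class v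
    class′ (suc u) = class u
    mono : ∀ u w → R u w → class′ u Fin.≤ class′ w
    mono zero    zero    _  = ℕ.≤-refl
    mono zero    (suc w) 0w = monotone (tra v0 0w)
    mono (suc u) zero    u0 = monotone (tra u0 0v)
    mono (suc u) (suc w) uw = monotone uw
    refl′ : ∀ u w → class′ u ≡ class′ w → R u w
    refl′ zero    zero    _  = rfl
    refl′ zero    (suc w) eq = tra 0v (reflects eq)
    refl′ (suc u) zero    eq = tra (reflects eq) v0
    refl′ (suc u) (suc w) eq = reflects eq
  insert (no incomparable) = record
    { classes = suc classes ; class = class′ ; surjective = surj
    ; monotone = λ {u} {w} → mono u w ; reflects = λ {u} {w} → refl′ u w }
    where
    below? : ∀ c → Dec (∃[ u ] (R (suc u) zero × c Fin.≤ class u))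
    below? c = any? λ u → R? (suc u) zero ×-dec (c Fin.≤? class u)
    cut = threshold below? λ i≤j (u , u0 , j≤u) → u , u0 , ℕ.≤-trans i≤j j≤u
    p = proj₁ cut
    class′ : Fin (suc n) → Fin (suc classes)
    class′ zero    = p
    class′ (suc u) = punchIn p (class u)
    surj : ∀ c → ∃[ v ] class′ v ≡ c
    surj c with p ≟ c
    ... | yes eq = zero , eq
    ... | no neq = let v , eq = surjective (punchOut neq) in
      suc v , trans (cong (punchIn p) eq) (punchIn-punchOut neq)
    mono : ∀ u w → R u w → class′ u Fin.≤ class′ w
    mono zero    zero    _  = ℕ.≤-refl
    -- If `w` were placed below `zero`, some predecessor `u` of `zero` would have a class at or
    -- above that of `w`. As `u` precedes `w` through `zero`, the classes agree, and `w` would be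
    -- equivalent to `zero`.
    mono zero    (suc w) 0w = ≤-punchIn p (class w) λ lt →
      let u , u0 , w≤u = proj₂ (proj₂ cut (class w)) lt
          w0 = tra (reflects (toℕ-injective (ℕ.≤-antisym w≤u (monotone (tra u0 0w))))) u0
      in incomparable (w , 0w , w0)
    mono (suc u) zero    u0 = punchIn-≤ p (class u) (proj₁ (proj₂ cut (class u)) (u , u0 , ℕ.≤-refl))
    mono (suc u) (suc w) uw = punchIn-mono-≤ p _ _ (monotone uw)
    refl′ : ∀ u w → class′ u ≡ class′ w → R u w
    refl′ zero    zero    _  = rfl
    refl′ zero    (suc w) eq = contradiction (sym eq) (punchInᵢ≢i p (class w))
    refl′ (suc u) zero    eq = contradiction eq (punchInᵢ≢i p (class u))
    refl′ (suc u) (suc w) eq = reflects (punchIn-injective p _ _ eq)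

-- Edge contraction and the size of a forest

module Contraction {n} {a b : Fin (suc n)} (b≢a : b ≢ a) where

  redirect : ∀ v → Σ[ w ∈ Fin (suc n) ] b ≢ w
  redirect v with b ≟ v
  ... | yes _  = a , b≢a
  ... | no b≢v = v , b≢v

  contract : Fin (suc n) → Fin n
  contract v = punchOut (proj₂ (redirect v))

  -- A colouring that is constant on the contracted edge factors through the contraction.
  punchIn-contract : ∀ {X : Set} (c : Fin (suc n) → X) → c a ≡ c b → ∀ v → c (punchIn b (contract v)) ≡ c v
  punchIn-contract c ca≡cb v = trans (cong c (punchIn-punchOut (proj₂ (redirect v)))) preserved
    where
    preserved : c (proj₁ (redirect v)) ≡ c v
    preserved with b ≟ v
    ... | yes refl = ca≡cb
    ... | no _     = refl

-- The edges form a forest in which s and t are not connected; contracting the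
-- first edge removes one vertex and keeps all the other separating colourings.
forest-bound : ∀ {n} k (x y : Fin k → Fin n) (c : Fin k → Fin n → Bool) →
  (∀ i → c i (x i) ≢ c i (y i)) → (∀ i j → i ≢ j → c i (x j) ≡ c i (y j)) →
  ∀ {s t} (c₀ : Fin n → Bool) → c₀ s ≢ c₀ t → (∀ i → c₀ (x i) ≡ c₀ (y i)) → 2 + k ≤ n
forest-bound {suc (suc n)} zero x y c _ _ c₀ _ _ = s≤s (s≤s z≤n)
-- One vertex cannot have two colours under `c₀`; this is the origin of the 2 in the bound.
forest-bound {suc zero} zero x y c _ _ {zero} {zero} c₀ s≢t _ = contradiction refl s≢t
forest-bound {zero} (suc k) x y c _ _ = ⊥-elim (Fin.¬Fin0 (x zero))
forest-bound {suc n} (suc k) x y c cross only {s} {t} c₀ s≢t c₀≡ = s≤s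
  (forest-bound k (contract ∘ x ∘ suc) (contract ∘ y ∘ suc) (λ i v → c (suc i) (punchIn b v))
    (λ i eq → cross (suc i) (trans (sym (kept i (x (suc i)))) (trans eq (kept i (y (suc i))))))
    (λ i j i≢j → trans (kept i _) (trans (only (suc i) (suc j) (i≢j ∘ Fin.suc-injective)) (sym (kept i _))))
    {contract s} {contract t} (c₀ ∘ punchIn b)
    (λ eq → s≢t (trans (sym (kept₀ s)) (trans eq (kept₀ t))))
    (λ i → trans (kept₀ _) (trans (c₀≡ (suc i)) (sym (kept₀ _)))))
  where
  b = y zero
  b≢a : b ≢ x zero
  b≢a eq = cross zero (cong (c zero) (sym eq))
  open Contraction b≢a
  -- Only its own colouring separates the ends of the first edge, so all later colourings descend to
  -- the contraction.
  kept : ∀ i v → c (suc i) (punchIn b (contract v)) ≡ c (suc i) v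
  kept i = punchIn-contract (c (suc i)) (only (suc i) zero λ ())
  kept₀ : ∀ v → c₀ (punchIn b (contract v)) ≡ c₀ v
  kept₀ = punchIn-contract c₀ (c₀≡ zero)

-- Flow across a cut

⟦_⟧ : Bool → ℤ
⟦ b ⟧ = if b then 1ℤ else 0ℤ

+∣tabulate∣ : ∀ {n} (b : Fin n → Bool) → + ∣ tabulate b ∣ ≡ sum λ i → ⟦ b i ⟧
+∣tabulate∣ {zero}  b = refl
+∣tabulate∣ {suc n} b with b zero
... | true  = cong (λ x → 1ℤ ℤ.+ x) (+∣tabulate∣ (b ∘ suc))
... | false = trans (+∣tabulate∣ (b ∘ suc)) (sym (ℤ.+-identityˡ _))

sum-zero : ∀ {n} (g : Fin n → ℤ) → (∀ i → g i ≡ 0ℤ) → sum g ≡ 0ℤ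
sum-zero {n} g g≡0 = trans (sum-cong-≗ g≡0) (sum-replicate-zero n)

sum-select : ∀ {n} (g : Fin n → ℤ) a x → (sum λ v → g v ℤ.* (if does (a ≟ v) then x else 0ℤ)) ≡ g a ℤ.* x
sum-select {suc n} g zero    x = trans
  (cong (λ y → g zero ℤ.* x ℤ.+ y) (sum-zero _ λ v → ℤ.*-zeroʳ (g (suc v))))
  (ℤ.+-identityʳ _)
sum-select {suc n} g (suc a) x = trans (cong₂ ℤ._+_ (ℤ.*-zeroʳ (g zero)) (sum-select (g ∘ suc) a x)) (ℤ.+-identityˡ _)

δ : ∀ {n} → Fin n → Fin n → ℤ
δ a v = ⟦ does (a ≟ v) ⟧

if-δ : ∀ b (x : ℤ) → (if b then x else 0ℤ) ≡ x ℤ.* ⟦ b ⟧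
if-δ true  x = sym (ℤ.*-identityʳ x)
if-δ false x = sym (ℤ.*-zeroʳ x)

δ-≢ : ∀ {n} {a v : Fin n} → a ≢ v → δ a v ≡ 0ℤ
δ-≢ {a = a} {v} a≢v = cong ⟦_⟧ (dec-false (a ≟ v) a≢v)

δ-refl : ∀ {n} (a : Fin n) → δ a a ≡ 1ℤ
δ-refl a = cong ⟦_⟧ (dec-true (a ≟ a) refl)

module _ {n m} (G : MultiGraph n m) where
  open MultiGraph G

  -- The signed incidence matrix; the row of a loop is zero.
  incidence : Fin m → Fin n → ℤ
  incidence e v = δ (end₁ e) v ℤ.- δ (end₂ e) v

  netOutflow-incidence : ∀ f v → netOutflow G f v ≡ sum λ e → f e ℤ.* incidence e v
  netOutflow-incidence f v = sum-cong-≗ λ e → trans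
    (cong₂ ℤ._-_ (if-δ (does (end₁ e ≟ v)) (f e)) (if-δ (does (end₂ e ≟ v)) (f e)))
    (identity (f e) _ _)
    where
    identity : ∀ x a b → x ℤ.* a ℤ.- x ℤ.* b ≡ x ℤ.* (a ℤ.- b)
    identity = ℤ-Solver.solve-∀

  sum-incidence : ∀ (g : Fin n → ℤ) e → (sum λ v → g v ℤ.* incidence e v) ≡ g (end₁ e) ℤ.- g (end₂ e)
  sum-incidence g e = begin
    (sum λ v → g v ℤ.* incidence e v)
      ≡⟨ sum-cong-≗ (λ v → split (g v) (δ (end₁ e) v) (δ (end₂ e) v)) ⟩
    (sum λ v → g v ℤ.* δ (end₁ e) v ℤ.+ -g v ℤ.* δ (end₂ e) v)
      ≡⟨ ∑-distrib-+ (λ v → g v ℤ.* δ (end₁ e) v) (λ v → -g v ℤ.* δ (end₂ e) v) ⟩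
    (sum λ v → g v ℤ.* δ (end₁ e) v) ℤ.+ (sum λ v → -g v ℤ.* δ (end₂ e) v)
      ≡⟨ cong₂ ℤ._+_ (trans (sum-select g (end₁ e) 1ℤ) (ℤ.*-identityʳ (g (end₁ e))))
                    (trans (sum-select -g (end₂ e) 1ℤ) (ℤ.*-identityʳ (-g (end₂ e)))) ⟩
    g (end₁ e) ℤ.- g (end₂ e) ∎
    where
    open ≡-Reasoning
    -g : Fin n → ℤ
    -g v = ℤ.- g v
    split : ∀ x a b → x ℤ.* (a ℤ.- b) ≡ x ℤ.* a ℤ.+ ℤ.- x ℤ.* b
    split = ℤ-Solver.solve-∀

  -- Summation by parts with a vertex potential `g`. When `g` is the indicator of a set, the
  -- right-hand side is the net flow out of that set.
  weighted-netOutflow : ∀ f (g : Fin n → ℤ) →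
    (sum λ v → g v ℤ.* netOutflow G f v) ≡ sum λ e → f e ℤ.* (g (end₁ e) ℤ.- g (end₂ e))
  weighted-netOutflow f g = begin
    (sum λ v → g v ℤ.* netOutflow G f v)
      ≡⟨ sum-cong-≗ (λ v → trans (cong (g v ℤ.*_) (netOutflow-incidence f v))
                                 (*-distribˡ-sum (g v) (λ e → f e ℤ.* incidence e v))) ⟩
    (sum λ v → sum λ e → g v ℤ.* (f e ℤ.* incidence e v))
      ≡⟨ ∑-comm (λ v e → g v ℤ.* (f e ℤ.* incidence e v)) ⟩
    (sum λ e → sum λ v → g v ℤ.* (f e ℤ.* incidence e v))
      ≡⟨ sum-cong-≗ (λ e → trans (sum-cong-≗ λ v → swap (g v) (f e) (incidence e v))
                                 (sym (*-distribˡ-sum (f e) (λ v → g v ℤ.* incidence e v)))) ⟩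
    (sum λ e → f e ℤ.* (sum λ v → g v ℤ.* incidence e v))
      ≡⟨ sum-cong-≗ (λ e → cong (f e ℤ.*_) (sum-incidence g e)) ⟩
    (sum λ e → f e ℤ.* (g (end₁ e) ℤ.- g (end₂ e))) ∎
    where
    open ≡-Reasoning
    swap : ∀ a b c → a ℤ.* (b ℤ.* c) ≡ b ℤ.* (a ℤ.* c)
    swap = ℤ-Solver.solve-∀

  module _ {s t} (s≢t : s ≢ t) {f} (isFlow : IsFlow G s t f) where
    open IsFlow isFlow

    -- Conservation removes every term except those of `s` and `t`.
    terminals : ∀ (g : Fin n → ℤ) →
      (sum λ v → g v ℤ.* netOutflow G f v) ≡ g s ℤ.* netOutflow G f s ℤ.+ g t ℤ.* netOutflow G f t
    terminals g = begin
      (sum λ v → g v ℤ.* netOutflow G f v)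
        ≡⟨ sum-cong-≗ (λ v → trans (cong (g v ℤ.*_) (only v)) (ℤ.*-distribˡ-+ (g v) _ _)) ⟩
      (sum λ v → g v ℤ.* at s v ℤ.+ g v ℤ.* at t v)
        ≡⟨ ∑-distrib-+ (λ v → g v ℤ.* at s v) (λ v → g v ℤ.* at t v) ⟩
      (sum λ v → g v ℤ.* at s v) ℤ.+ (sum λ v → g v ℤ.* at t v)
        ≡⟨ cong₂ ℤ._+_ (sum-select g s _) (sum-select g t _) ⟩
      g s ℤ.* netOutflow G f s ℤ.+ g t ℤ.* netOutflow G f t ∎
      where
      open ≡-Reasoning
      at : Fin n → Fin n → ℤ
      at a v = if does (a ≟ v) then netOutflow G f a else 0ℤ
      only : ∀ v → netOutflow G f v ≡ at s v ℤ.+ at t v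
      only v with s ≟ v | t ≟ v
      ... | yes refl | yes refl = contradiction refl s≢t
      ... | yes refl | no _     = sym (ℤ.+-identityʳ _)
      ... | no _     | yes refl = sym (ℤ.+-identityˡ _)
      ... | no s≢v   | no t≢v   = conservation v (s≢v ∘ sym) (t≢v ∘ sym)

    -- A constant potential has no difference along any edge, so the two terminal outflows cancel.
    netOutflow-sink : netOutflow G f t ≡ ℤ.- value G s t f
    netOutflow-sink = cancel _ _ (begin
      1ℤ ℤ.* netOutflow G f s ℤ.+ 1ℤ ℤ.* netOutflow G f t ≡⟨ terminals (λ _ → 1ℤ) ⟨
      (sum λ v → 1ℤ ℤ.* netOutflow G f v)                ≡⟨ weighted-netOutflow f (λ _ → 1ℤ) ⟩
      (sum λ e → f e ℤ.* 0ℤ)                             ≡⟨ sum-zero _ (λ e → ℤ.*-zeroʳ (f e)) ⟩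
      0ℤ                                                 ∎)
      where
      open ≡-Reasoning
      solve-for : ∀ a b → b ≡ (1ℤ ℤ.* a ℤ.+ 1ℤ ℤ.* b) ℤ.- a
      solve-for = ℤ-Solver.solve-∀
      cancel : ∀ a b → 1ℤ ℤ.* a ℤ.+ 1ℤ ℤ.* b ≡ 0ℤ → b ≡ ℤ.- a
      cancel a b eq = trans (solve-for a b) (trans (cong (ℤ._- a) eq) (ℤ.+-identityˡ _))

    -- The weighted net outflow is evaluated once over the edges and once at the terminals. For the
    -- indicator of an (s,t)-cut the factor `g s - g t` is 1.
    flow-across : ∀ (g : Fin n → ℤ) →
      (sum λ e → f e ℤ.* (g (end₁ e) ℤ.- g (end₂ e))) ≡ (g s ℤ.- g t) ℤ.* value G s t f
    flow-across g = begin
      (sum λ e → f e ℤ.* (g (end₁ e) ℤ.- g (end₂ e)))     ≡⟨ weighted-netOutflow f g ⟨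
      (sum λ v → g v ℤ.* netOutflow G f v)               ≡⟨ terminals g ⟩
      g s ℤ.* val ℤ.+ g t ℤ.* netOutflow G f t           ≡⟨ cong (λ x → g s ℤ.* val ℤ.+ g t ℤ.* x) netOutflow-sink ⟩
      g s ℤ.* val ℤ.+ g t ℤ.* ℤ.- val                    ≡⟨ identity (g s) (g t) val ⟩
      (g s ℤ.- g t) ℤ.* val                              ∎
      where
      open ≡-Reasoning
      val = value G s t f
      identity : ∀ a b x → a ℤ.* x ℤ.+ b ℤ.* ℤ.- x ≡ (a ℤ.- b) ℤ.* x
      identity = ℤ-Solver.solve-∀

-- An edge without flow is oriented from end₁ to end₂, arbitrarily.
source target : ∀ {A : Set} → ℤ → A → A → A
source z x y = if does (z ℤ.≟ -1ℤ) then y else x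
target z x y = source z y x

-- Contributing edges sorted by the direction of their flow

module Orientation {n m} (G : MultiGraph n m) (f : Fin m → ℤ) where
  open MultiGraph G

  src tgt : Fin m → Fin n
  src e = source (f e) (end₁ e) (end₂ e)
  tgt e = target (f e) (end₁ e) (end₂ e)

  module _ (c : Fin n → Bool) where

    -- An arbitrary colouring is allowed because these sets are also needed for levels of the
    -- numbering and for sets closed under flow, which may fail to be (s,t)-cuts.
    Leaving Entering Unused : Fin m → Set
    Leaving  e = f e ≢ 0ℤ × c (src e) ≡ true × c (tgt e) ≡ false
    Entering e = f e ≢ 0ℤ × c (src e) ≡ false × c (tgt e) ≡ true
    Unused   e = f e ≡ 0ℤ × c (end₁ e) ≢ c (end₂ e)

    leaving? : Decidable Leaving
    leaving? e = ¬? (f e ℤ.≟ 0ℤ) ×-dec (c (src e) ≟ᵇ true) ×-dec (c (tgt e) ≟ᵇ false)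

    entering? : Decidable Entering
    entering? e = ¬? (f e ℤ.≟ 0ℤ) ×-dec (c (src e) ≟ᵇ false) ×-dec (c (tgt e) ≟ᵇ true)

    unused? : Decidable Unused
    unused? e = (f e ℤ.≟ 0ℤ) ×-dec ¬? (c (end₁ e) ≟ᵇ c (end₂ e))

    leaving entering unused : Subset m
    leaving  = subsetOf leaving?
    entering = subsetOf entering?
    unused   = subsetOf unused?

  module _ (bounded : ∀ e → ℤ.∣ f e ∣ ≤ 1) where

    -- The edgewise form of the net flow out of `c`; the bound leaves only the flows 1, 0 and -1 to
    -- check.
    leaving-entering : ∀ c e → ⟦ does (leaving? c e) ⟧ ≡
      ⟦ does (entering? c e) ⟧ ℤ.+ f e ℤ.* (⟦ c (end₁ e) ⟧ ℤ.- ⟦ c (end₂ e) ⟧)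
    leaving-entering c e with f e | bounded e
    ... | + 0        | _ = refl
    ... | + 1 | _ with c (end₁ e) | c (end₂ e)
    ...   | true  | true  = refl
    ...   | true  | false = refl
    ...   | false | true  = refl
    ...   | false | false = refl
    leaving-entering c e | -[1+ 0 ] | _ with c (end₁ e) | c (end₂ e)
    ...   | true  | true  = refl
    ...   | true  | false = refl
    ...   | false | true  = refl
    ...   | false | false = refl
    leaving-entering c e | + suc (suc _) | s≤s ()
    leaving-entering c e | -[1+ suc _ ] | s≤s ()

    contributing-split : ∀ c e → (if c (end₁ e) xor c (end₂ e) then 1 else 0) ≡
      (if does (leaving? c e) then 1 else 0) +
      ((if does (entering? c e) then 1 else 0) + (if does (unused? c e) then 1 else 0))
    contributing-split c e with f e | bounded e
    ... | + 0 | _ with c (end₁ e) | c (end₂ e)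
    ...   | true  | true  = refl
    ...   | true  | false = refl
    ...   | false | true  = refl
    ...   | false | false = refl
    contributing-split c e | + 1 | _ with c (end₁ e) | c (end₂ e)
    ...   | true  | true  = refl
    ...   | true  | false = refl
    ...   | false | true  = refl
    ...   | false | false = refl
    contributing-split c e | -[1+ 0 ] | _ with c (end₁ e) | c (end₂ e)
    ...   | true  | true  = refl
    ...   | true  | false = refl
    ...   | false | true  = refl
    ...   | false | false = refl
    contributing-split c e | + suc (suc _) | s≤s ()
    contributing-split c e | -[1+ suc _ ] | s≤s ()

    capacity-split : ∀ C → let c = lookup C in
      capacity G C ≡ ∣ leaving c ∣ + (∣ entering c ∣ + ∣ unused c ∣)
    capacity-split C = begin
      capacity G C                         ≡⟨ ∣tabulate∣ (λ e → c (end₁ e) xor c (end₂ e)) ⟩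
      sumℕ (λ e → if c (end₁ e) xor c (end₂ e) then 1 else 0)
                                           ≡⟨ sumℕ-cong (contributing-split c) ⟩
      sumℕ (λ e → l e + (i e + u e))       ≡⟨ ∑ℕ-distrib-+ l (λ e → i e + u e) ⟩
      sumℕ l + sumℕ (λ e → i e + u e)      ≡⟨ cong (λ x → sumℕ l + x) (∑ℕ-distrib-+ i u) ⟩
      sumℕ l + (sumℕ i + sumℕ u)           ≡⟨ cong₂ _+_ (∣tabulate∣ (λ e → does (leaving? c e)))
                                             (cong₂ _+_ (∣tabulate∣ (λ e → does (entering? c e)))
                                                        (∣tabulate∣ (λ e → does (unused? c e)))) ⟨
      ∣ leaving c ∣ + (∣ entering c ∣ + ∣ unused c ∣) ∎
      where
      open ≡-Reasoning
      c = lookup C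
      l i u : Fin m → ℕ
      l e = if does (leaving? c e) then 1 else 0
      i e = if does (entering? c e) then 1 else 0
      u e = if does (unused? c e) then 1 else 0

  ∣leaving∣ : ∀ {s t} → s ≢ t → IsFlow G s t f → ∀ c →
    + ∣ leaving c ∣ ≡ + ∣ entering c ∣ ℤ.+ (⟦ c s ⟧ ℤ.- ⟦ c t ⟧) ℤ.* value G s t f
  ∣leaving∣ {s} {t} s≢t isFlow c = begin
    + ∣ leaving c ∣
      ≡⟨ +∣tabulate∣ (λ e → does (leaving? c e)) ⟩
    (sum λ e → ⟦ does (leaving? c e) ⟧)
      ≡⟨ sum-cong-≗ (leaving-entering (IsFlow.capacityBound isFlow) c) ⟩
    (sum λ e → ⟦ does (entering? c e) ⟧ ℤ.+ f e ℤ.* (⟦ c (end₁ e) ⟧ ℤ.- ⟦ c (end₂ e) ⟧))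
      ≡⟨ ∑-distrib-+ (λ e → ⟦ does (entering? c e) ⟧) (λ e → f e ℤ.* (⟦ c (end₁ e) ⟧ ℤ.- ⟦ c (end₂ e) ⟧)) ⟩
    (sum λ e → ⟦ does (entering? c e) ⟧) ℤ.+ (sum λ e → f e ℤ.* (⟦ c (end₁ e) ⟧ ℤ.- ⟦ c (end₂ e) ⟧))
      ≡⟨ cong₂ ℤ._+_ (sym (+∣tabulate∣ (λ e → does (entering? c e)))) (flow-across G s≢t isFlow (λ v → ⟦ c v ⟧)) ⟩
    + ∣ entering c ∣ ℤ.+ (⟦ c s ⟧ ℤ.- ⟦ c t ⟧) ℤ.* value G s t f ∎
    where open ≡-Reasoning

-- Augmenting flow along the residual graph

module Augmentation {n m} (G : MultiGraph n m) {s t : Fin n} (s≢t : s ≢ t) {f}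
  (isFlow : IsFlow G s t f) where
  open MultiGraph G
  open IsFlow isFlow

  -- Arcs of positive residual capacity; an undirected edge without flow yields one in each
  -- direction.
  Residual : Fin n → Fin n → Set
  Residual u w = ∃[ e ] ((end₁ e ≡ u × end₂ e ≡ w × f e ≢ 1ℤ) ⊎ (end₂ e ≡ u × end₁ e ≡ w × f e ≢ -1ℤ))

  residual? : ∀ u w → Dec (Residual u w)
  residual? u w = any? λ e →
    ((end₁ e ≟ u) ×-dec (end₂ e ≟ w) ×-dec ¬? (f e ℤ.≟ 1ℤ)) ⊎-dec
    ((end₂ e ≟ u) ×-dec (end₁ e ≟ w) ×-dec ¬? (f e ℤ.≟ -1ℤ))

  -- A unit of flow is sent on from s to v along edges inside S, so that every
  -- edge leaving S still has its original residual capacity.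
  record Sent (S : Subset n) (v : Fin n) : Set where
    field
      g           : Fin m → ℤ
      bounded     : ∀ e → ℤ.∣ g e ∣ ≤ 1
      unchanged   : ∀ e → ¬ (end₁ e ∈ S × end₂ e ∈ S) → g e ≡ f e
      outflow     : ∀ w → netOutflow G g w ≡ netOutflow G f w ℤ.+ (δ s w ℤ.- δ v w)

  push : (Fin m → ℤ) → Fin m → ℤ → Fin m → ℤ
  push g e d x = g x ℤ.+ (if does (e ≟ x) then d else 0ℤ)

  netOutflow-push : ∀ g e d w → netOutflow G (push g e d) w ≡ netOutflow G g w ℤ.+ incidence G e w ℤ.* d
  netOutflow-push g e d w = begin
    netOutflow G (push g e d) w
      ≡⟨ netOutflow-incidence G (push g e d) w ⟩
    (sum λ x → push g e d x ℤ.* incidence G x w)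
      ≡⟨ sum-cong-≗ (λ x → distrib (g x) (at x) (incidence G x w)) ⟩
    (sum λ x → g x ℤ.* incidence G x w ℤ.+ incidence G x w ℤ.* at x)
      ≡⟨ ∑-distrib-+ (λ x → g x ℤ.* incidence G x w) (λ x → incidence G x w ℤ.* at x) ⟩
    (sum λ x → g x ℤ.* incidence G x w) ℤ.+ (sum λ x → incidence G x w ℤ.* at x)
      ≡⟨ cong₂ ℤ._+_ (sym (netOutflow-incidence G g w)) (sum-select (λ x → incidence G x w) e d) ⟩
    netOutflow G g w ℤ.+ incidence G e w ℤ.* d ∎
    where
    open ≡-Reasoning
    at : Fin m → ℤ
    at x = if does (e ≟ x) then d else 0ℤ
    distrib : ∀ a b c → (a ℤ.+ b) ℤ.* c ≡ a ℤ.* c ℤ.+ c ℤ.* b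
    distrib = ℤ-Solver.solve-∀

  -- As `e` does not lie inside `S`, its flow is still `f e` and the bound on `f e + d` applies. The
  -- net outflows telescope from `s` through `u` to `w`.
  send : ∀ {S u w} → Sent S u → w ∉ S → ∀ e d → ℤ.∣ f e ℤ.+ d ∣ ≤ 1 →
    ¬ (end₁ e ∈ S × end₂ e ∈ S) → (end₁ e ∈ S ∪ ⁅ w ⁆ × end₂ e ∈ S ∪ ⁅ w ⁆) →
    (∀ x → incidence G e x ℤ.* d ≡ δ u x ℤ.- δ w x) → Sent (S ∪ ⁅ w ⁆) w
  send {S} {u} {w} sent w∉ e d ok fresh within inc = record
    { g = push g e d
    ; bounded = bnd
    ; unchanged = unch
    ; outflow = λ x → trans (netOutflow-push g e d x)
        (trans (cong₂ ℤ._+_ (outflow x) (inc x)) (telescope (netOutflow G f x) (δ s x) (δ u x) (δ w x)))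
    }
    where
    open Sent sent
    telescope : ∀ a p q r → a ℤ.+ (p ℤ.- q) ℤ.+ (q ℤ.- r) ≡ a ℤ.+ (p ℤ.- r)
    telescope = ℤ-Solver.solve-∀
    bnd : ∀ x → ℤ.∣ push g e d x ∣ ≤ 1
    bnd x with e ≟ x
    ... | yes refl = subst (λ y → ℤ.∣ y ℤ.+ d ∣ ≤ 1) (sym (unchanged e fresh)) ok
    ... | no _     = subst (λ y → ℤ.∣ y ∣ ≤ 1) (sym (ℤ.+-identityʳ (g x))) (bounded x)
    unch : ∀ x → ¬ (end₁ x ∈ S ∪ ⁅ w ⁆ × end₂ x ∈ S ∪ ⁅ w ⁆) → push g e d x ≡ f x
    unch x out with e ≟ x
    ... | yes refl = contradiction within out
    ... | no _     = trans (ℤ.+-identityʳ (g x)) (unchanged x λ (a , b) → out (p⊆p∪q ⁅ w ⁆ a , p⊆p∪q ⁅ w ⁆ b))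

  extend : ∀ {S u w} → (∀ v → v ∈ S → Sent S v) → u ∈ S → w ∉ S → Residual u w →
    ∀ v → v ∈ S ∪ ⁅ w ⁆ → Sent (S ∪ ⁅ w ⁆) v
  extend {S} {u} {w} sent u∈ w∉ uw v v∈ with x∈p∪q⁻ S ⁅ w ⁆ v∈
  ... | inj₁ v∈S = record
    { g = g ; bounded = bounded ; outflow = outflow
    ; unchanged = λ x out → unchanged x λ (a , b) → out (p⊆p∪q ⁅ w ⁆ a , p⊆p∪q ⁅ w ⁆ b) }
    where open Sent (sent v v∈S)
  ... | inj₂ v∈w with x∈⁅y⁆⇒x≡y w v∈w | uw
  ...   | refl | e , inj₁ (refl , refl , f≢1) = send (sent u u∈) w∉ e 1ℤ up (w∉ ∘ proj₂)
      (p⊆p∪q ⁅ w ⁆ u∈ , q⊆p∪q S ⁅ w ⁆ (x∈⁅x⁆ w)) (λ x → ℤ.*-identityʳ _)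
    where
    up : ℤ.∣ f e ℤ.+ 1ℤ ∣ ≤ 1
    up with f e | capacityBound e
    ... | + 0           | _     = s≤s z≤n
    ... | + 1           | _     = contradiction refl f≢1
    ... | -[1+ 0 ]      | _     = z≤n
    ... | + suc (suc _) | s≤s ()
    ... | -[1+ suc _ ]  | s≤s ()
  ...   | refl | e , inj₂ (refl , refl , f≢-1) = send (sent u u∈) w∉ e -1ℤ down (w∉ ∘ proj₁)
      (q⊆p∪q S ⁅ w ⁆ (x∈⁅x⁆ w) , p⊆p∪q ⁅ w ⁆ u∈) (λ x → reverse (δ w x) (δ u x))
    where
    reverse : ∀ a b → (a ℤ.- b) ℤ.* -1ℤ ≡ b ℤ.- a
    reverse = ℤ-Solver.solve-∀
    down : ℤ.∣ f e ℤ.+ -1ℤ ∣ ≤ 1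
    down with f e | capacityBound e
    ... | + 0           | _     = s≤s z≤n
    ... | + 1           | _     = z≤n
    ... | -[1+ 0 ]      | _     = contradiction refl f≢-1
    ... | + suc (suc _) | s≤s ()
    ... | -[1+ suc _ ]  | s≤s ()

  sent-start : ∀ v → v ∈ ⁅ s ⁆ → Sent ⁅ s ⁆ v
  sent-start v v∈ with x∈⁅y⁆⇒x≡y s v∈
  ... | refl = record
    { g = f ; bounded = capacityBound ; unchanged = λ _ _ → refl
    ; outflow = λ w → sym (trans (cong (λ x → netOutflow G f w ℤ.+ x) (ℤ.+-inverseʳ (δ s w))) (ℤ.+-identityʳ _)) }

  -- A unit sent all the way to `t` disturbs conservation only at the terminals and raises the value
  -- by one.
  sent-sink⇒¬max : ∀ {S} → Sent S t → ¬ (∀ g → IsFlow G s t g → value G s t g ℤ.≤ value G s t f)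
  sent-sink⇒¬max sent max = ℤ.<⇒≱ (ℤ.suc[i]≤j⇒i<j ℤ.≤-refl)
    (subst (ℤ._≤ value G s t f) (trans (outflow s) augmented) (max g flow))
    where
    open Sent sent
    augmented : netOutflow G f s ℤ.+ (δ s s ℤ.- δ t s) ≡ ℤ.suc (value G s t f)
    augmented = trans (cong₂ (λ a b → netOutflow G f s ℤ.+ (a ℤ.- b)) (δ-refl s) (δ-≢ (s≢t ∘ sym)))
      (ℤ.+-comm (netOutflow G f s) 1ℤ)
    flow : IsFlow G s t g
    flow = record
      { capacityBound = bounded
      ; conservation = λ v v≢s v≢t → trans (outflow v)
          (trans (cong₂ (λ a b → netOutflow G f v ℤ.+ (a ℤ.- b)) (δ-≢ (v≢s ∘ sym)) (δ-≢ (v≢t ∘ sym)))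
          (trans (ℤ.+-identityʳ _) (conservation v v≢s v≢t))) }

-- Membership as a Boolean value

∈⇒lookup : ∀ {n} {C : Subset n} {v} → v ∈ C → lookup C v ≡ true
∈⇒lookup = []=⇒lookup

lookup⇒∈ : ∀ {n} {C : Subset n} {v} → lookup C v ≡ true → v ∈ C
lookup⇒∈ {C = C} {v} = lookup⇒[]= v C

∉⇒lookup : ∀ {n} {C : Subset n} {v} → v ∉ C → lookup C v ≡ false
∉⇒lookup {C = C} {v} v∉ with lookup C v in eq
... | true  = contradiction (lookup⇒∈ {C = C} eq) v∉
... | false = refl

lookup⇒∉ : ∀ {n} {C : Subset n} {v} → lookup C v ≡ false → v ∉ C
lookup⇒∉ eq v∈ with () ← trans (sym eq) (∈⇒lookup v∈)

-- Max-flow min-cut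
module MaxFlow {n m} (G : MultiGraph n m) {s t : Fin n} (s≢t : s ≢ t)
  {lam} (minCut : IsMinCutCapacity G s t lam) {f} (maxFlow : IsMaxFlow G s t f) where
  open MultiGraph G
  open Orientation G f
  open Augmentation G s≢t (proj₁ maxFlow)

  private
    isFlow = proj₁ maxFlow
    bounded = IsFlow.capacityBound isFlow

  leaving-cut : ∀ {C} → IsCut G s t C →
    + ∣ leaving (lookup C) ∣ ≡ + ∣ entering (lookup C) ∣ ℤ.+ value G s t f
  leaving-cut {C} (s∈ , t∉) = trans (∣leaving∣ s≢t isFlow (lookup C))
    (cong (λ x → + ∣ entering (lookup C) ∣ ℤ.+ x)
      (trans (cong₂ (λ a b → (⟦ a ⟧ ℤ.- ⟦ b ⟧) ℤ.* value G s t f) (∈⇒lookup s∈) (∉⇒lookup t∉))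
             (ℤ.*-identityˡ _)))

  saturated-cut : ∃[ T ] (IsCut G s t T × ∣ entering (lookup T) ∣ ≡ 0 × ∣ unused (lookup T) ∣ ≡ 0)
  saturated-cut = T , (s∈T , t∉T) , ∉⇒∣∣≡0 _ (λ e e∈ → none-entering e (∈-subsetOf⁻ (entering? (lookup T)) e∈))
                , ∉⇒∣∣≡0 _ (λ e e∈ → none-unused e (∈-subsetOf⁻ (unused? (lookup T)) e∈))
    where
    region = closure residual? (λ S → ∀ v → v ∈ S → Sent S v) extend sent-start
    T = proj₁ region
    s∈T = proj₁ (proj₂ region) (x∈⁅x⁆ s)
    t∉T : t ∉ T
    t∉T t∈ = sent-sink⇒¬max (proj₁ (proj₂ (proj₂ region)) t t∈) (proj₂ maxFlow)
    closed = proj₂ (proj₂ (proj₂ region))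
    forward : ∀ e → f e ≢ 1ℤ → end₁ e ∈ T → end₂ e ∈ T
    forward e f≢1 x∈ = closed x∈ (e , inj₁ (refl , refl , f≢1))
    backward : ∀ e → f e ≢ -1ℤ → end₂ e ∈ T → end₁ e ∈ T
    backward e f≢-1 y∈ = closed y∈ (e , inj₂ (refl , refl , f≢-1))
    none-entering : ∀ e → ¬ Entering (lookup T) e
    none-entering e (f≢0 , src∉ , tgt∈) with f e | bounded e | forward e | backward e
    ... | + 0           | _ | _ | _      = f≢0 refl
    ... | + 1           | _ | _ | bwd    = lookup⇒∉ {C = T} src∉ (bwd (λ ()) (lookup⇒∈ tgt∈))
    ... | -[1+ 0 ]      | _ | fwd | _    = lookup⇒∉ {C = T} src∉ (fwd (λ ()) (lookup⇒∈ tgt∈))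
    ... | + suc (suc _) | s≤s () | _ | _
    ... | -[1+ suc _ ]  | s≤s () | _ | _
    none-unused : ∀ e → ¬ Unused (lookup T) e
    none-unused e (f≡0 , ends≢) with lookup T (end₁ e) in eq₁ | lookup T (end₂ e) in eq₂
    ... | true  | true  = ends≢ refl
    ... | false | false = ends≢ refl
    ... | true  | false = lookup⇒∉ {C = T} eq₂ (forward e (λ f≡1 → 0≢1 (trans (sym f≡0) f≡1)) (lookup⇒∈ eq₁))
      where
      0≢1 : 0ℤ ≢ 1ℤ
      0≢1 ()
    ... | false | true  = lookup⇒∉ {C = T} eq₁ (backward e (λ f≡-1 → 0≢-1 (trans (sym f≡0) f≡-1)) (lookup⇒∈ eq₂))
      where
      0≢-1 : 0ℤ ≢ -1ℤ
      0≢-1 ()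

  -- Every cut bounds the value from above, since its leaving edges are among its contributing
  -- edges; `saturated-cut` attains the bound.
  value≡ : value G s t f ≡ + lam
  value≡ = ℤ.≤-antisym value≤lam lam≤value
    where
    value≤lam : value G s t f ℤ.≤ + lam
    value≤lam = let C , isCut , cap≡ = proj₁ minCut in subst (value G s t f ℤ.≤_) (cong +_ cap≡)
      (ℤ.≤-trans (ℤ.≤-trans (ℤ.i≤j+i _ (+ ∣ entering (lookup C) ∣)) (ℤ.≤-reflexive (sym (leaving-cut isCut))))
                 (ℤ.+≤+ (subst (∣ leaving (lookup C) ∣ ≤_) (sym (capacity-split bounded C)) (ℕ.m≤m+n _ _))))
    lam≤value : + lam ℤ.≤ value G s t f
    lam≤value =
      let T , isCut , e≡0 , u≡0 = saturated-cut
          cap≡ = trans (capacity-split bounded T)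
                   (trans (cong₂ (λ a b → ∣ leaving (lookup T) ∣ + (a + b)) e≡0 u≡0) (ℕ.+-identityʳ _))
          val≡ = trans (leaving-cut isCut) (trans (cong (λ a → + a ℤ.+ value G s t f) e≡0) (ℤ.+-identityˡ _))
      in subst (+ lam ℤ.≤_) (trans (cong +_ cap≡) val≡) (ℤ.+≤+ (proj₂ minCut T isCut))

  -- Each entering flow edge forces one additional leaving edge, since the net flow is fixed; hence
  -- the factor 2.
  capacity≡ : ∀ {C} → IsCut G s t C →
    capacity G C ≡ lam + (2 * ∣ entering (lookup C) ∣ + ∣ unused (lookup C) ∣)
  capacity≡ {C} isCut = trans (capacity-split bounded C)
    (trans (cong (_+ (E + U)) (ℤ.+-injective (trans (leaving-cut isCut) (cong (λ x → + E ℤ.+ x) value≡))))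
           (identity E lam U))
    where
    E = ∣ entering (lookup C) ∣
    U = ∣ unused (lookup C) ∣
    identity : ∀ a b c → a + b + (a + c) ≡ b + (2 * a + c)
    identity = ℕ-Solver.solve-∀

  ∣leaving∣-value : ∀ c → + ∣ leaving c ∣ ≡ + ∣ entering c ∣ ℤ.+ (⟦ c s ⟧ ℤ.- ⟦ c t ⟧) ℤ.* + lam
  ∣leaving∣-value c = trans (∣leaving∣ s≢t isFlow c)
    (cong (λ x → + ∣ entering c ∣ ℤ.+ (⟦ c s ⟧ ℤ.- ⟦ c t ⟧) ℤ.* x) value≡)

  -- The net flow out of a set is `lam`, 0 or `- lam`, according to which terminals it contains. The
  -- bound is applied to the levels of the numbering.
  ∣leaving∣≤ : ∀ c → ∣ leaving c ∣ ≤ ∣ entering c ∣ + lam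
  ∣leaving∣≤ c = ℤ.drop‿+≤+ (ℤ.≤-trans (ℤ.≤-reflexive (∣leaving∣-value c)) (ℤ.+-monoʳ-≤ (+ ∣ entering c ∣) at-most))
    where
    at-most : (⟦ c s ⟧ ℤ.- ⟦ c t ⟧) ℤ.* + lam ℤ.≤ + lam
    at-most with c s | c t
    ... | true  | true  = ℤ.+≤+ z≤n
    ... | true  | false = ℤ.≤-reflexive (ℤ.*-identityˡ _)
    ... | false | true  = ℤ.≤-trans (ℤ.≤-reflexive (ℤ.-1*i≡-i (+ lam))) ℤ.neg-≤-pos
    ... | false | false = ℤ.+≤+ z≤n

  -- Without the sink inside, the net flow out is `lam` or 0. The bound is applied to sets that flow
  -- cannot leave.
  ∣entering∣≤ : ∀ c → c t ≡ false → ∣ entering c ∣ ≤ ∣ leaving c ∣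
  ∣entering∣≤ c t∉ = ℤ.drop‿+≤+ (ℤ.≤-trans (at-least (c s)) (ℤ.≤-reflexive (sym
    (trans (∣leaving∣-value c) (cong (λ b → + ∣ entering c ∣ ℤ.+ (⟦ c s ⟧ ℤ.- ⟦ b ⟧) ℤ.* + lam) t∉)))))
    where
    at-least : ∀ b → + ∣ entering c ∣ ℤ.≤ + ∣ entering c ∣ ℤ.+ (⟦ b ⟧ ℤ.- 0ℤ) ℤ.* + lam
    at-least true  = ℤ.≤-trans (ℤ.+≤+ (ℕ.m≤m+n ∣ entering c ∣ lam))
      (ℤ.≤-reflexive (cong (λ x → + ∣ entering c ∣ ℤ.+ x) (sym (ℤ.*-identityˡ (+ lam)))))
    at-least false = ℤ.≤-reflexive (sym (ℤ.+-identityʳ _))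

-- Paths across a cut of a DAG

xor-≢ : ∀ {a b} → a ≢ b → a xor b ≡ true
xor-≢ {true}  {true}  a≢b = contradiction refl a≢b
xor-≢ {true}  {false} _   = refl
xor-≢ {false} {true}  _   = refl
xor-≢ {false} {false} a≢b = contradiction refl a≢b

module CutPaths {n} (D : DAG n) (C : Subset n) where
  open DAG D

  crossings : ∀ {x y} → Path x y → ℕ
  crossings p = length (filter (_∈? dagEdgeSet C) (pathEdges p))

  side : Fin nodes → Bool
  side = lookup (image C)

  lookup-dagEdgeSet : ∀ e → lookup (dagEdgeSet C) e ≡ side (tail e) xor side (head e)
  lookup-dagEdgeSet = lookup∘tabulate _

  xor-≡ : ∀ {a b} → a ≡ b → a xor b ≡ false
  xor-≡ {true}  refl = refl
  xor-≡ {false} refl = refl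

  crossing-step : ∀ {x y z} ((e , te , he) : x ⟶ y) (p : Path y z) → side x ≢ side y →
    crossings ((e , te , he) ◅ p) ≡ suc (crossings p)
  crossing-step (e , refl , refl) p x≢y =
    cong length (filter-accept (_∈? dagEdgeSet C) (lookup⇒∈ (trans (lookup-dagEdgeSet e) (xor-≢ x≢y))))

  staying-step : ∀ {x y z} ((e , te , he) : x ⟶ y) (p : Path y z) → side x ≡ side y →
    crossings ((e , te , he) ◅ p) ≡ crossings p
  staying-step (e , refl , refl) p x≡y =
    cong length (filter-reject (_∈? dagEdgeSet C) (lookup⇒∉ (trans (lookup-dagEdgeSet e) (xor-≡ x≡y))))

  separated⇒crossings : ∀ {x y} (p : Path x y) → side x ≢ side y → 1 ≤ crossings p
  separated⇒crossings ε x≢y = contradiction refl x≢y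
  separated⇒crossings {x} (_◅_ {j = z} e p) x≢y with side x ≟ᵇ side z
  ... | yes x≡z = subst (1 ≤_) (sym (staying-step e p x≡z)) (separated⇒crossings p λ z≡y → x≢y (trans x≡z z≡y))
  ... | no x≢z  = subst (1 ≤_) (sym (crossing-step e p x≢z)) (s≤s z≤n)

  module _ (never-entered : ∀ e → side (head e) ≡ true → side (tail e) ≡ true) where

    outside-path : ∀ {x y} (p : Path x y) → side x ≡ false → crossings p ≡ 0
    outside-path ε x∉ = refl
    outside-path {x} ((e , refl , refl) ◅ p) x∉ with side (head e) in eq
    ... | true  with () ← trans (sym x∉) (never-entered e eq)
    ... | false = trans (staying-step (e , refl , refl) p (trans x∉ (sym eq))) (outside-path p eq)

    -- A path that has left the cut can never re-enter it, so only the leaving edge is counted.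
    crossings≤1 : ∀ {x y} (p : Path x y) → crossings p ≤ 1
    crossings≤1 ε = z≤n
    crossings≤1 ((e , refl , refl) ◅ p) with side (tail e) ≟ᵇ side (head e)
    ... | yes x≡y = subst (_≤ 1) (sym (staying-step (e , refl , refl) p x≡y)) (crossings≤1 p)
    ... | no x≢y  = subst (_≤ 1) (sym (crossing-step (e , refl , refl) p x≢y))
                      (s≤s (ℕ.≤-reflexive (outside-path p (leaves (side (head e)) refl))))
      where
      leaves : ∀ b → side (head e) ≡ b → side (head e) ≡ false
      leaves true  eq = contradiction (trans (never-entered e eq) (sym eq)) x≢y
      leaves false eq = eq

  module _ (unsplit : IsCutIn C) where

    same-block : ∀ {u v} → node u ≡ node v → lookup C u ≡ lookup C v
    same-block {u} {v} eq with lookup C u in eu | lookup C v in ev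
    ... | true  | true  = refl
    ... | false | false = refl
    ... | true  | false = contradiction (unsplit u v eq (lookup⇒∈ eu)) (lookup⇒∉ ev)
    ... | false | true  = contradiction (unsplit v u (sym eq) (lookup⇒∈ ev)) (lookup⇒∉ eu)

    block? : Decidable λ x → ∃[ v ] (v ∈ C × node v ≡ x)
    block? x = any? λ v → (v ∈? C) ×-dec (node v ≟ x)

    -- The image contains a block as soon as one of its vertices is in `C`; when `C` is unsplit, all
    -- of them are.
    side-node : ∀ v → side (node v) ≡ lookup C v
    side-node v with lookup C v in eq
    ... | true  = ∈⇒lookup (∈-subsetOf⁺ block? (v , lookup⇒∈ eq , refl))
    ... | false = ∉⇒lookup λ v∈ →
      let u , u∈ , node≡ = ∈-subsetOf⁻ block? v∈ in lookup⇒∉ eq (unsplit u v node≡ u∈)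

-- Contributing edges and auxiliary size estimates

contributing-xor : ∀ {n m} (G : MultiGraph n m) C e → let open MultiGraph G in
  lookup (contributing G C) e ≡ lookup C (end₁ e) xor lookup C (end₂ e)
contributing-xor G C = lookup∘tabulate _

contributing⇒≢ : ∀ {n m} (G : MultiGraph n m) {C e} → let open MultiGraph G in
  e ∈ contributing G C → lookup C (end₁ e) ≢ lookup C (end₂ e)
contributing⇒≢ G {C} {e} e∈ eq with lookup C (MultiGraph.end₁ G e) | lookup C (MultiGraph.end₂ G e)
  | trans (sym (contributing-xor G C e)) (∈⇒lookup e∈)
contributing⇒≢ G e∈ refl | true  | true  | ()
contributing⇒≢ G e∈ refl | false | false | ()

≢⇒contributing : ∀ {n m} (G : MultiGraph n m) {C e} → let open MultiGraph G in
  lookup C (end₁ e) ≢ lookup C (end₂ e) → e ∈ contributing G C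
≢⇒contributing G {C} {e} ends≢ = lookup⇒∈ (trans (contributing-xor G C e) (xor-≢ ends≢))

bounded-by-sqrt : ∀ {x m n k} c L → x ≤ c * m → x ≤ c * n * L → L * L ≤ k → BoundedByMin c x m n k
bounded-by-sqrt {x} {m} {n} {k} c L x≤cm x≤cnL LL≤k = x≤cm , (begin
  x ^ 2                    ≤⟨ ℕ.^-monoˡ-≤ 2 x≤cnL ⟩
  (c * n * L) ^ 2          ≡⟨ identity (c * n) L ⟩
  (c * n) ^ 2 * (L * L)    ≤⟨ ℕ.*-monoʳ-≤ ((c * n) ^ 2) LL≤k ⟩
  (c * n) ^ 2 * k          ∎)
  where
  open ℕ.≤-Reasoning
  identity : ∀ a b → (a * b) * ((a * b) * 1) ≡ (a * (a * 1)) * (b * b)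
  identity = ℕ-Solver.solve-∀

-- A vertex is coded by an incident edge together with the choice of one of its two ends.
vertices≤2edges : ∀ {n m} (G : MultiGraph n m) → NoIsolatedVertex G → n ≤ m * 2
vertices≤2edges {n} {m} G covered = injective⇒≤ {f = code} λ {u} {v} eq →
  trans (sym (decode-code u)) (trans (cong decode eq) (decode-code v))
  where
  open MultiGraph G
  end : Fin m × Fin 2 → Fin n
  end (e , zero)  = end₁ e
  end (e , suc _) = end₂ e
  decode : Fin (m * 2) → Fin n
  decode x = end (remQuot 2 x)
  locate : ∀ v → ∃[ p ] end p ≡ v
  locate v with covered v
  ... | e , inj₁ eq = (e , zero) , eq
  ... | e , inj₂ eq = (e , suc zero) , eq
  code : Fin n → Fin (m * 2)
  code v = combine (proj₁ (proj₁ (locate v))) (proj₂ (proj₁ (locate v)))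
  decode-code : ∀ v → decode (code v) ≡ v
  decode-code v = trans (cong end (remQuot-combine (proj₁ (proj₁ (locate v))) _)) (proj₂ (locate v))

-- Anchor edges and the steps that define the DAG

module Anchors {n m} (G : MultiGraph n m) {s t : Fin n} (s≢t : s ≢ t)
  {lam} (minCut : IsMinCutCapacity G s t lam) {f} (maxFlow : IsMaxFlow G s t f) where
  open MultiGraph G
  open Orientation G f
  open MaxFlow G s≢t minCut maxFlow

  Anchor : Fin m → Set
  Anchor = IsAnchor G s t lam f

  anchor? : Decidable Anchor
  anchor? e = (f e ℤ.≟ 0ℤ) ×-dec anySubset? λ C →
    ((s ∈? C) ×-dec ¬? (t ∈? C)) ×-dec (capacity G C ℕ.≟ suc lam) ×-dec (e ∈? contributing G C)

  anchors : Subset m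
  anchors = subsetOf anchor?

  mincut⇒ : ∀ {C} → IsCut G s t C → capacity G C ≡ lam →
    ∣ entering (lookup C) ∣ ≡ 0 × ∣ unused (lookup C) ∣ ≡ 0
  mincut⇒ {C} isCut cap≡ = ℕ.m+n≡0⇒m≡0 _ (ℕ.m+n≡0⇒m≡0 _ rest≡0) , ℕ.m+n≡0⇒n≡0 _ rest≡0
    where
    rest≡0 : 2 * ∣ entering (lookup C) ∣ + ∣ unused (lookup C) ∣ ≡ 0
    rest≡0 = ℕ.+-cancelˡ-≡ lam _ 0 (trans (sym (capacity≡ isCut)) (trans cap≡ (sym (ℕ.+-identityʳ lam))))

  -- Entering edges count twice, so an excess of one can only come from a single edge without flow.
  min+1cut⇒ : ∀ {C} → IsCut G s t C → capacity G C ≡ suc lam →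
    ∣ entering (lookup C) ∣ ≡ 0 × ∣ unused (lookup C) ∣ ≡ 1
  min+1cut⇒ {C} isCut cap≡ = odd _ _
    (ℕ.+-cancelˡ-≡ lam _ 1 (trans (sym (capacity≡ isCut)) (trans cap≡ (ℕ.+-comm 1 lam))))
    where
    odd : ∀ e u → 2 * e + u ≡ 1 → e ≡ 0 × u ≡ 1
    odd zero    u eq = refl , eq
    odd (suc e) u eq with () ← ℕ.m+n≡0⇒n≡0 e (ℕ.m+n≡0⇒m≡0 _ (ℕ.suc-injective eq))

  cut-separates : ∀ {C} → IsCut G s t C → lookup C s ≢ lookup C t
  cut-separates (s∈ , t∉) eq = contradiction (trans (sym (∈⇒lookup s∈)) (trans eq (∉⇒lookup t∉))) λ ()

  ∣anchors∣ : 2 + ∣ anchors ∣ ≤ n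
  ∣anchors∣ = forest-bound ∣ anchors ∣ (end₁ ∘ edge) (end₂ ∘ edge) (λ i → lookup (cut i))
    (λ i → contributing⇒≢ G {cut i} (crosses i)) only {s} {t} (lookup C₀) (cut-separates isCut₀)
    λ i → decidable-stable (_ ≟ᵇ _) λ ends≢ →
      ∣p∣≡0⇒∉ (unused (lookup C₀)) (proj₂ (mincut⇒ isCut₀ cap₀)) (unused∋ C₀ i ends≢)
    where
    C₀ = proj₁ (proj₁ minCut)
    isCut₀ = proj₁ (proj₂ (proj₁ minCut))
    cap₀ = proj₂ (proj₂ (proj₁ minCut))
    edge = enum anchors
    spec : ∀ i → Anchor (edge i)
    spec i = ∈-subsetOf⁻ anchor? (enum-∈ anchors i)
    cut : ∀ i → Subset n
    cut i = proj₁ (proj₂ (spec i))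
    crosses : ∀ i → edge i ∈ contributing G (cut i)
    crosses i = proj₂ (proj₂ (proj₂ (proj₂ (spec i))))
    unused∋ : ∀ C i → lookup C (end₁ (edge i)) ≢ lookup C (end₂ (edge i)) → edge i ∈ unused (lookup C)
    unused∋ C i ends≢ = ∈-subsetOf⁺ (unused? (lookup C)) (proj₁ (spec i) , ends≢)
    only : ∀ i j → i ≢ j → lookup (cut i) (end₁ (edge j)) ≡ lookup (cut i) (end₂ (edge j))
    only i j i≢j = decidable-stable (_ ≟ᵇ _) λ ends≢ → i≢j (enum-injective anchors
      (∣p∣≡1⇒unique (unused (lookup (cut i)))
        (proj₂ (min+1cut⇒ (proj₁ (proj₂ (proj₂ (spec i)))) (proj₁ (proj₂ (proj₂ (proj₂ (spec i)))))))
        (unused∋ (cut i) i (contributing⇒≢ G {cut i} (crosses i)))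
        (unused∋ (cut i) j ends≢)))

  -- The strongly connected components of Step are the nodes of the DAG.

  Carries Joins Step : Fin n → Fin n → Set
  Carries u v = ∃[ e ] (f e ≢ 0ℤ × src e ≡ u × tgt e ≡ v)
  Joins u v = ∃[ e ] ((f e ≡ 0ℤ × ¬ Anchor e) × ((end₁ e ≡ u × end₂ e ≡ v) ⊎ (end₂ e ≡ u × end₁ e ≡ v)))
  Step u v = Carries u v ⊎ Joins u v

  carries? : ∀ u v → Dec (Carries u v)
  carries? u v = any? λ e → ¬? (f e ℤ.≟ 0ℤ) ×-dec (src e ≟ u) ×-dec (tgt e ≟ v)

  step? : ∀ u v → Dec (Step u v)
  step? u v = carries? u v ⊎-dec any? λ e → ((f e ℤ.≟ 0ℤ) ×-dec ¬? (anchor? e)) ×-dec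
    (((end₁ e ≟ u) ×-dec (end₂ e ≟ v)) ⊎-dec ((end₂ e ≟ u) ×-dec (end₁ e ≟ v)))

  numbering : Numbering (Star Step)
  numbering = number (Star? step?) ε _◅◅_

-- The numbering is a parameter so that its construction is never unfolded.
module Condensation {n m} (G : MultiGraph n m) {s t : Fin n} (s≢t : s ≢ t)
  {lam} (minCut : IsMinCutCapacity G s t lam) {f} (maxFlow : IsMaxFlow G s t f)
  (numbering : Numbering (Star (Anchors.Step G s≢t minCut maxFlow))) where
  open MultiGraph G
  open Orientation G f
  open MaxFlow G s≢t minCut maxFlow
  open Anchors G s≢t minCut maxFlow hiding (numbering)
  open Numbering numbering

  class-≡ : ∀ {u v} → Star Step u v → Star Step v u → class u ≡ class v
  class-≡ uv vu = Fin.≤-antisym (monotone uv) (monotone vu)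

  classes≤ : classes ≤ n
  classes≤ = injective⇒≤ {f = λ c → proj₁ (surjective c)} λ {c} {d} eq →
    trans (sym (proj₂ (surjective c))) (trans (cong class eq) (proj₂ (surjective d)))

  carry : ∀ e → f e ≢ 0ℤ → Star Step (src e) (tgt e)
  carry e f≢0 = inj₁ (e , f≢0 , refl , refl) ◅ ε

  Between : Fin m → Set
  Between e = f e ≢ 0ℤ × class (src e) ≢ class (tgt e)

  -- Coding the two classes as one number lets parallel flow edges share an arc, so that the DAG is
  -- simple, as the count by length requires.
  arc : Fin m → Fin (classes * classes)
  arc e = combine (class (src e)) (class (tgt e))

  arc? : Decidable λ x → ∃[ e ] (Between e × arc e ≡ x)
  arc? x = any? λ e → (¬? (f e ℤ.≟ 0ℤ) ×-dec ¬? (class (src e) ≟ class (tgt e))) ×-dec (arc e ≟ x)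

  arcs : Subset (classes * classes)
  arcs = subsetOf arc?

  from to : Fin ∣ arcs ∣ → Fin classes
  from i = proj₁ (remQuot classes (enum arcs i))
  to   i = proj₂ (remQuot {classes} classes (enum arcs i))

  ends-injective : ∀ {i j} → from i ≡ from j → to i ≡ to j → i ≡ j
  ends-injective {i} {j} eqf eqt = enum-injective arcs
    (trans (sym (combine-remQuot {classes} classes (enum arcs i)))
    (trans (cong₂ combine eqf eqt) (combine-remQuot {classes} classes (enum arcs j))))

  arc-ends : ∀ {i e} → arc e ≡ enum arcs i → from i ≡ class (src e) × to i ≡ class (tgt e)
  arc-ends {i} {e} eq = cong proj₁ split , cong proj₂ split
    where
    split : remQuot classes (enum arcs i) ≡ (class (src e) , class (tgt e))
    split = trans (cong (remQuot classes) (sym eq)) (remQuot-combine _ _)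

  representative : Fin ∣ arcs ∣ → Fin m
  representative i = proj₁ (∈-subsetOf⁻ arc? (enum-∈ arcs i))

  representative-between : ∀ i → Between (representative i)
  representative-between i = proj₁ (proj₂ (∈-subsetOf⁻ arc? (enum-∈ arcs i)))

  representative-arc : ∀ i → arc (representative i) ≡ enum arcs i
  representative-arc i = proj₂ (proj₂ (∈-subsetOf⁻ arc? (enum-∈ arcs i)))

  representative-injective : ∀ {i j} → representative i ≡ representative j → i ≡ j
  representative-injective {i} {j} eq = enum-injective arcs
    (trans (sym (representative-arc i)) (trans (cong arc eq) (representative-arc j)))

  arc-of : ∀ e → Between e → ∃[ i ] (from i ≡ class (src e) × to i ≡ class (tgt e))
  arc-of e between =
    let i , eq = enum-surjective arcs (∈-subsetOf⁺ arc? (e , between , refl))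
    in i , arc-ends (sym eq)

  -- A flow edge is a step, so it never goes down in the numbering. This yields both acyclicity and
  -- the layering used in the size bound.
  from<to : ∀ i → from i Fin.< to i
  from<to i =
    let e = representative i
        f≢0 , class≢ = representative-between i
        eqf , eqt = arc-ends (representative-arc i)
    in subst₂ Fin._<_ (sym eqf) (sym eqt) (Fin.≤∧≢⇒< (monotone (carry e f≢0)) class≢)

  D : DAG n
  D = record
    { nodes = classes ; edges = ∣ arcs ∣ ; node = class ; nonempty = surjective
    ; tail = from ; head = to
    ; acyclic = λ x cycle → ℕ.<-irrefl refl (increasing cycle) }
    where
    increasing : ∀ {x y} → TransClosure (λ x y → ∃[ e ] (from e ≡ x × to e ≡ y)) x y → x Fin.< y
    increasing [ e , refl , refl ] = from<to e
    increasing ((e , refl , refl) ∷ p) = ℕ.<-trans (from<to e) (increasing p)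

  -- The size of the DAG

  edges≤m : DAG.edges D ≤ m
  edges≤m = injective⇒≤ representative-injective

  -- No flow enters the set of vertices of class at most `j`, so at most `lam` flow edges leave it.
  -- Each arc straddling `j` is represented by a different one of them.
  level≤ : ∀ j → ∣ subsetOf (λ i → straddles? from to from<to ends-injective i j) ∣ ≤ lam
  level≤ j = ℕ.≤-trans
    (∣∣-mono-injection _ (leaving below) representative
      (λ {i} i∈ → ∈-subsetOf⁺ (leaving? below) (leaves i
        (∈-subsetOf⁻ (λ i → straddles? from to from<to ends-injective i j) i∈)))
      (λ _ _ → representative-injective))
    (subst (λ k → ∣ leaving below ∣ ≤ k + lam) none (∣leaving∣≤ below))
    where
    below : Fin n → Bool
    below v = does (class v Fin.≤? j)
    leaves : ∀ i → from i Fin.≤ j × j Fin.< to i → Leaving below (representative i)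
    leaves i (lo , hi) =
      let eqf , eqt = arc-ends (representative-arc i)
      in proj₁ (representative-between i)
       , dec-true (_ Fin.≤? j) (subst (Fin._≤ j) eqf lo)
       , dec-false (_ Fin.≤? j) (ℕ.<⇒≱ (subst (j Fin.<_) eqt hi))
    none : ∣ entering below ∣ ≡ 0
    none = ∉⇒∣∣≡0 _ λ e e∈ →
      let f≢0 , src∉ , tgt∈ = ∈-subsetOf⁻ (entering? below) e∈
          tgt≤j = decidable-stable (class (tgt e) Fin.≤? j) λ nle →
            contradiction (trans (sym tgt∈) (dec-false (_ Fin.≤? j) nle)) λ ()
      in contradiction (trans (sym src∉) (dec-true (_ Fin.≤? j) (ℕ.≤-trans (monotone (carry e f≢0)) tgt≤j))) λ ()

  edges≤sqrt : ∃[ L ] (L * L ≤ lam × (1 ≤ lam → 1 ≤ L) × DAG.edges D ≤ 5 * n * L)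
  edges≤sqrt =
    let L , LL≤ , pos , X≤ = size≤sqrt {N = classes} (size≤ from to from<to ends-injective lam level≤)
                                       (size-bound from to from<to ends-injective lam level≤)
    in L , LL≤ , pos , ℕ.≤-trans X≤ (ℕ.*-monoˡ-≤ L (ℕ.*-monoʳ-≤ 5 classes≤))

  edges-bound : BoundedByMin 8 (DAG.edges D) m n lam
  edges-bound =
    let L , LL≤ , _ , X≤ = edges≤sqrt
    in bounded-by-sqrt {m = m} {n} 8 L (ℕ.≤-trans edges≤m (ℕ.m≤n*m m 8))
         -- The 5 is relaxed to 8 so that one constant serves the edge bound and the space bound.
         (ℕ.≤-trans X≤ (ℕ.*-monoˡ-≤ L (ℕ.*-monoˡ-≤ n (ℕ.m≤m+n 5 3)))) LL≤

  space≤ : ∀ {x} → DAG.edges D ≤ x → space D anchors ≤ 3 * n + x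
  space≤ {x} X≤ = begin
    n + classes + ∣ arcs ∣ + ∣ anchors ∣
      ≤⟨ ℕ.+-mono-≤ (ℕ.+-mono-≤ (ℕ.+-monoʳ-≤ n classes≤) X≤) (ℕ.≤-trans (ℕ.m≤n+m _ 2) ∣anchors∣) ⟩
    n + n + x + n ≡⟨ identity n x ⟩
    3 * n + x     ∎
    where
    open ℕ.≤-Reasoning
    identity : ∀ n x → n + n + x + n ≡ 3 * n + x
    identity = ℕ-Solver.solve-∀

  -- Without isolated vertices `n` is at most `2 * m`, and `1 ≤ lam` gives `1 ≤ L`; so the terms
  -- linear in `n` are absorbed by either bound. The 8 is the sum of 3 from these terms and 5 from
  -- the arcs.
  space-bound : 1 ≤ lam → NoIsolatedVertex G → BoundedByMin 8 (space D anchors) m n lam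
  space-bound 1≤lam covered =
    let L , LL≤ , pos , X≤ = edges≤sqrt
    in bounded-by-sqrt {m = m} {n} 8 L linear (root L (pos 1≤lam) X≤) LL≤
    where
    open ℕ.≤-Reasoning
    linear : space D anchors ≤ 8 * m
    linear = begin
      space D anchors   ≤⟨ space≤ edges≤m ⟩
      3 * n + m         ≤⟨ ℕ.+-monoˡ-≤ m (ℕ.*-monoʳ-≤ 3 (vertices≤2edges G covered)) ⟩
      3 * (m * 2) + m   ≤⟨ ℕ.m≤m+n _ m ⟩
      3 * (m * 2) + m + m ≡⟨ identity m ⟩
      8 * m             ∎
      where
      identity : ∀ m → 3 * (m * 2) + m + m ≡ 8 * m
      identity = ℕ-Solver.solve-∀
    root : ∀ L → 1 ≤ L → DAG.edges D ≤ 5 * n * L → space D anchors ≤ 8 * n * L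
    root (suc k) _ X≤ = begin
      space D anchors         ≤⟨ space≤ X≤ ⟩
      3 * n + 5 * n * suc k   ≤⟨ ℕ.+-monoˡ-≤ _ (ℕ.m≤m*n (3 * n) (suc k)) ⟩
      3 * n * suc k + 5 * n * suc k ≡⟨ identity n (suc k) ⟩
      8 * n * suc k           ∎
      where
      identity : ∀ n l → 3 * n * l + 5 * n * l ≡ 8 * n * l
      identity = ℕ-Solver.solve-∀

  -- Transversal cuts and mincuts

  module _ {C} (isCut : IsCut G s t C) where
    open DAG D using (OneTransversal; Path; IsCutIn)
    open CutPaths D C

    private c = lookup C

    anchors∩contributing : (∀ e → Unused c e → Anchor e) → ∣ anchors ∩ contributing G C ∣ ≡ ∣ unused c ∣
    anchors∩contributing unused⇒anchor = cong ∣_∣ (⊆-antisym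
      (λ e∈ → let e∈A , e∈C = x∈p∩q⁻ anchors (contributing G C) e∈
              in ∈-subsetOf⁺ (unused? c) (proj₁ (∈-subsetOf⁻ anchor? e∈A) , contributing⇒≢ G {C} e∈C))
      (λ e∈ → let u = ∈-subsetOf⁻ (unused? c) e∈
              in x∈p∩q⁺ (∈-subsetOf⁺ anchor? (unused⇒anchor _ u) , ≢⇒contributing G {C} (proj₂ u))))

    -- Membership in `C` passes backward along every step: flow edges do not enter `C`, and
    -- non-anchors without flow do not cross it. Hence no strong component is split and no arc
    -- enters `C`.
    closed⇒transversal : ∣ entering c ∣ ≡ 0 → (∀ e → Unused c e → Anchor e) → OneTransversal C
    closed⇒transversal none unused⇒anchor = unsplit , crossings≤1 λ i →
      subst₂ (λ a b → side a ≡ true → side b ≡ true) (sym (proj₂ (rep-ends i))) (sym (proj₁ (rep-ends i)))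
        λ in-tgt → trans (side-node unsplit _)
          (back (inj₁ (representative i , proj₁ (representative-between i) , refl , refl))
                                                     (trans (sym (side-node unsplit _)) in-tgt))
      where
      rep-ends : ∀ i → from i ≡ class (src (representative i)) × to i ≡ class (tgt (representative i))
      rep-ends i = arc-ends (representative-arc i)
      back : ∀ {u v} → Step u v → c v ≡ true → c u ≡ true
      back (inj₁ (e , f≢0 , refl , refl)) v∈ with c (src e) in eq
      ... | true  = refl
      ... | false = contradiction (∈-subsetOf⁺ (entering? c) (f≢0 , eq , v∈)) (∣p∣≡0⇒∉ _ none)
      back (inj₂ (e , (f≡0 , ¬anchor) , ends)) v∈ = along ends
        where
        equal : c (end₁ e) ≡ c (end₂ e)
        equal = decidable-stable (_ ≟ᵇ _) λ ends≢ → ¬anchor (unused⇒anchor e (f≡0 , ends≢))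
        along : (end₁ e ≡ _ × end₂ e ≡ _) ⊎ (end₂ e ≡ _ × end₁ e ≡ _) → c _ ≡ true
        along (inj₁ (refl , refl)) = trans equal v∈
        along (inj₂ (refl , refl)) = trans (sym equal) v∈
      back* : ∀ {u v} → Star Step u v → c v ≡ true → c u ≡ true
      back* ε         v∈ = v∈
      back* (uw ◅ wv) v∈ = back uw (back* wv v∈)
      unsplit : IsCutIn C
      unsplit u v eq u∈ = lookup⇒∈ (back* (reflects (sym eq)) (∈⇒lookup u∈))

    -- Flow edges inside a class are skipped; the others become arcs.
    flow-path : ∀ {u v} → Star Carries u v → Path (class u) (class v)
    flow-path ε = ε
    flow-path {u} {v} (_◅_ {j = w} uw wv) with class u ≟ class w
    ... | yes eq = subst (λ x → Path x (class v)) (sym eq) (flow-path wv)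
    flow-path ((e , f≢0 , refl , refl) ◅ wv) | no class≢ = arc-of e (f≢0 , class≢) ◅ flow-path wv

    -- Otherwise flow enters the set of vertices reachable from tgt e, but none leaves it.
    returns-or-reaches-sink : ∀ e → f e ≢ 0ℤ → Star Carries (tgt e) (src e) ⊎ Star Carries (tgt e) t
    returns-or-reaches-sink e f≢0 with t ∈? reach | src e ∈? reach
      where open Reachability carries? (tgt e)
    ... | yes t∈ | _       = inj₂ (Reachability.∈reach⇒Star carries? (tgt e) t∈)
    ... | no _   | yes s∈  = inj₁ (Reachability.∈reach⇒Star carries? (tgt e) s∈)
    ... | no t∉  | no src∉ = contradiction
      (∈-subsetOf⁺ (entering? r) (f≢0 , ∉⇒lookup src∉ , ∈⇒lookup start∈reach))
      (∣p∣≡0⇒∉ _ (ℕ.n≤0⇒n≡0 (subst (∣ entering r ∣ ≤_) none (∣entering∣≤ r (∉⇒lookup t∉)))))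
      where
      open Reachability carries? (tgt e)
      r = lookup reach
      none : ∣ leaving r ∣ ≡ 0
      none = ∉⇒∣∣≡0 _ λ x x∈ → let f≢0 , src∈ , tgt∉ = ∈-subsetOf⁻ (leaving? r) x∈ in
        lookup⇒∉ tgt∉ (reach-closed (lookup⇒∈ src∈) (x , f≢0 , refl , refl))

    -- A non-anchor without flow has both ends in one block, so an unsplit cut is crossed by no such
    -- edge. A flow edge entering `C` would force either a split block or a path with two crossings.
    transversal⇒closed : OneTransversal C → ∣ entering c ∣ ≡ 0 × ∣ anchors ∩ contributing G C ∣ ≡ ∣ unused c ∣
    transversal⇒closed (unsplit , once) =
        ∉⇒∣∣≡0 _ (λ e e∈ → ¬entering e (∈-subsetOf⁻ (entering? c) e∈))
      , anchors∩contributing λ e (f≡0 , ends≢) → decidable-stable (anchor? e) λ ¬anchor →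
          ends≢ (same-block unsplit (class-≡
            (inj₂ (e , (f≡0 , ¬anchor) , inj₁ (refl , refl)) ◅ ε)
            (inj₂ (e , (f≡0 , ¬anchor) , inj₂ (refl , refl)) ◅ ε)))
      where
      weaken : ∀ {u v} → Star Carries u v → Star Step u v
      weaken ε         = ε
      weaken (uw ◅ wv) = inj₁ uw ◅ weaken wv
      ¬entering : ∀ e → ¬ Entering c e
      ¬entering e (f≢0 , src∉ , tgt∈) with returns-or-reaches-sink e f≢0
      -- Flow returning to the tail puts both ends of `e` in one block, although they lie on
      -- different sides.
      ... | inj₁ back = contradiction
        (trans (sym src∉) (trans (same-block unsplit (class-≡ (carry e f≢0) (weaken back))) tgt∈)) λ ()
      -- The arc of `e` enters the cut, and the path `p` onward to the block of `t` must leave it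
      -- again.
      ... | inj₂ on = ℕ.<⇒≱ (s≤s second) (subst (_≤ 1) first (once (a ◅ p)))
        where
        a = arc-of e (f≢0 , λ eq → contradiction (trans (sym src∉) (trans (same-block unsplit eq) tgt∈)) λ ())
        p = flow-path on
        side-src : side (class (src e)) ≡ false
        side-src = trans (side-node unsplit _) src∉
        side-tgt : side (class (tgt e)) ≡ true
        side-tgt = trans (side-node unsplit _) tgt∈
        side-t : side (class t) ≡ false
        side-t = trans (side-node unsplit t) (∉⇒lookup (proj₂ isCut))
        first : crossings (a ◅ p) ≡ suc (crossings p)
        first = crossing-step a p λ eq → contradiction (trans (sym side-src) (trans eq side-tgt)) λ ()
        second : 1 ≤ crossings p
        second = separated⇒crossings p λ eq → contradiction (trans (sym side-t) (trans (sym eq) side-tgt)) λ ()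

    transversal-capacity : OneTransversal C → capacity G C ≡ lam + ∣ anchors ∩ contributing G C ∣
    transversal-capacity transversal =
      let e≡0 , a≡u = transversal⇒closed transversal
      in trans (capacity≡ isCut) (cong₂ (λ a b → lam + (2 * a + b)) e≡0 (sym a≡u))

    mincut⇔ : capacity G C ≡ lam ⇔ (OneTransversal C × ∣ anchors ∩ contributing G C ∣ ≡ 0)
    mincut⇔ = mk⇔
      (λ cap≡ →
        let e≡0 , u≡0 = mincut⇒ isCut cap≡
            -- The anchor condition holds vacuously.
            no-unused = λ e u → contradiction (∈-subsetOf⁺ (unused? c) u) (∣p∣≡0⇒∉ _ u≡0)
        in closed⇒transversal e≡0 no-unused , trans (anchors∩contributing no-unused) u≡0)
      (λ (transversal , a≡0) → trans (transversal-capacity transversal)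
        (trans (cong (λ x → lam + x) a≡0) (ℕ.+-identityʳ lam)))

    min+1cut⇔ : capacity G C ≡ suc lam ⇔ (OneTransversal C × ∣ anchors ∩ contributing G C ∣ ≡ 1)
    min+1cut⇔ = mk⇔
      (λ cap≡ →
        let e≡0 , u≡1 = min+1cut⇒ isCut cap≡
            unused⇒anchor = λ e u → proj₁ u , C , isCut , cap≡ , ≢⇒contributing G {C} {e} (proj₂ u)
        in closed⇒transversal e≡0 unused⇒anchor , trans (anchors∩contributing unused⇒anchor) u≡1)
      (λ (transversal , a≡1) → trans (transversal-capacity transversal)
        (trans (cong (λ x → lam + x) a≡1) (ℕ.+-comm lam 1)))

theorem4 :
  Σ[ c ∈ ℕ ]
  (∀ (n m : ℕ) (G : MultiGraph n m) (s t : Fin n) → s ≢ t →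
   ∀ (lam : ℕ) → IsMinCutCapacity G s t lam →
   ∀ (f : Fin m → ℤ) → IsMaxFlow G s t f →
   Σ[ D ∈ DAG n ] Σ[ A ∈ Subset m ]
     ( (∀ e → e ∈ A ⇔ IsAnchor G s t lam f e)
     × ∣ A ∣ ≤ n ∸ 2
     × BoundedByMin c (DAG.edges D) m n lam
     × (1 ≤ lam → NoIsolatedVertex G → BoundedByMin c (space D A) m n lam)
     × (∀ C → IsCut G s t C →
          capacity G C ≡ lam ⇔
          (DAG.OneTransversal D C × ∣ A ∩ contributing G C ∣ ≡ 0))
     × (∀ C → IsCut G s t C →
          capacity G C ≡ suc lam ⇔
          (DAG.OneTransversal D C × ∣ A ∩ contributing G C ∣ ≡ 1)) ))
theorem4 = 8 , λ n m G s t s≢t lam minCut f maxFlow →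
  let open Anchors G s≢t minCut maxFlow
      open Condensation G s≢t minCut maxFlow numbering in
  D , anchors
  , (λ e → mk⇔ (∈-subsetOf⁻ anchor?) (∈-subsetOf⁺ anchor?))
  , ℕ.∸-monoˡ-≤ 2 ∣anchors∣
  , edges-bound
  , space-bound
  , (λ C → mincut⇔)
  , (λ C → min+1cut⇔)
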